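{- Let $k\ge 1$ and $m\ge 2$ be integers and let $L\subseteq\{0,1,\dots,k-1\}$. Write $a=\min\{i\ge 0: i\notin L\}$ and $b=\min\{i\ge a: i\in L \text{ or } i=k\}$. Suppose that a finite set system $\mathcal{F}$ of $k$-element sets contains no $L$-sunflower with $m$ petals (in particular, this holds if $\mathcal{F}$ has no $L$-clique of size $m$). Then there exists a subfamily $\mathcal{F}'\subseteq\mathcal{F}$ with $|\mathcal{F}'|\ge c_k\, m^{ -k+b-a}\,|\mathcal{F}|$ that avoids intersections of size in $L$, where $c_k>0$ depends only on $k$. Moreover, this bound is tight for $L$-sunflowers for every $L\subseteq\{0,\dots,k-1\}$: there is $C_k>0$ depending only on $k$ such that $r_{\mathrm{sf}}(k,L,m)\le C_k m^{ -k+b-a}$ for all $m\ge2$; that is, $r_{\mathrm{sf}}(k,L,m)=\Theta_k(m^{ -k+b-a})$.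
   Context: A sunflower with $t$ petals is a collection of distinct sets $F_1,\dots,F_t$ such that $F_i\cap F_j=\bigcap_{\ell=1}^t F_\ell$ for all $i\ne j$; the set $\bigcap_\ell F_\ell$ is its kernel. It is an $L$-sunflower if the size of its kernel lies in $L$. Sets $F_1,\dots,F_t$ form an $L$-clique of size $t$ if $|F_i\cap F_j|\in L$ for all $i<j$. A family avoids intersections of size in $L$ if no two distinct members $F,F'$ satisfy $|F\cap F'|\in L$. For integers $k\ge1,m\ge2$ and $L\subseteq\{0,\dots,k-1\}$, $r_{\mathrm{sf}}(k,L,m)$ is the supremum of all $\alpha\ge0$ such that whenever a finite set system $\mathcal F$ of $k$-element sets contains no $L$-sunflower with $m$ petals, there is $\mathcal F'\subseteq\mathcal F$ with $|\mathcal F'|\ge\alpha|\mathcal F|$ avoiding intersections of size in $L$. The notation $\Theta_k,\Omega_k,O_k$ hides multiplicative constants depending only on $k$. -}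

module Defs where

open import Data.Nat using (ℕ; _<_; _≤_)
open import Data.Fin using (Fin)
open import Data.Fin.Subset using (Subset; _∩_; ⋂; ∣_∣)
open import Data.List using (List; tabulate; length)
open import Data.List.Membership.Propositional using (_∈_; _∉_)
open import Data.List.Relation.Unary.All using (All)
open import Data.List.Relation.Unary.Unique.Propositional using (Unique)
open import Data.List.Relation.Unary.AllPairs using (AllPairs)
open import Data.Product using (Σ; _×_)
open import Data.Sum using (_⊎_)
open import Data.Rational using (ℚ; 0ℚ; _/_) renaming (_≤_ to _≤ℚ_; _*_ to _*ℚ_)
open import Data.Integer using (+_)
open import Relation.Binary.PropositionalEquality using (_≡_; _≢_)
open import Relation.Nullary using (¬_)
open import Function.Definitions using (Injective)

-- Intersection-size sets L ⊆ {0,…,k-1} are finite lists of naturals,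
-- each entry < k (duplicates are harmless).
SizeSet : ℕ → Set
SizeSet k = Σ (List ℕ) (λ L → All (_< k) L)

IsA : List ℕ → ℕ → Set
IsA L a = a ∉ L × (∀ i → i < a → i ∈ L)

IsB : ℕ → List ℕ → ℕ → ℕ → Set
IsB k L a b = a ≤ b × (b ∈ L ⊎ b ≡ k)
            × (∀ i → a ≤ i → i < b → (i ∉ L × i ≢ k))

-- A finite set system on the ground set Fin n: a duplicate-free list of subsets.
Family : ℕ → Set
Family n = List (Subset n)

Uniform : ∀ {n} → ℕ → Family n → Set
Uniform k F = All (λ A → ∣ A ∣ ≡ k) F

kernel : ∀ {n t} → (Fin t → Subset n) → Subset n
kernel S = ⋂ (tabulate S)

IsSunflower : ∀ {n t} → (Fin t → Subset n) → Set
IsSunflower {t = t} S = Injective _≡_ _≡_ S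
  × (∀ (i j : Fin t) → i ≢ j → S i ∩ S j ≡ kernel S)

HasLSunflower : ∀ {n} → List ℕ → ℕ → Family n → Set
HasLSunflower {n} L t F = Σ (Fin t → Subset n) λ S →
  IsSunflower S × (∀ i → S i ∈ F) × (∣ kernel S ∣ ∈ L)

SubFamily : ∀ {n} → Family n → Family n → Set
SubFamily F' F = Unique F' × All (_∈ F) F'

AvoidsL : ∀ {n} → List ℕ → Family n → Set
AvoidsL L F' = AllPairs (λ A B → ¬ (∣ A ∩ B ∣ ∈ L)) F'

ℕtoℚ : ℕ → ℚ
ℕtoℚ x = + x / 1

-- α (a nonnegative rational) is admissible in the definition of r_sf(k,L,m):
-- every finite k-uniform family without L-sunflowers with m petals has a
-- subfamily of size ≥ α|F| avoiding intersections of size in L.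
Admissible : ℕ → List ℕ → ℕ → ℚ → Set
Admissible k L m α = 0ℚ ≤ℚ α × (∀ (n : ℕ) (F : Family n) → Unique F → Uniform k F →
  ¬ HasLSunflower L m F →
  Σ (Family n) λ F' → SubFamily F' F × AvoidsL L F' × (α *ℚ ℕtoℚ (length F) ≤ℚ ℕtoℚ (length F')))

{-# OPTIONS --safe #-}
module Submission where

-- Existence.  Without a sunflower of m petals with kernel T, at most km vertices outside T meet every member containing T.
-- Following such covers from ∅ through the sizes 0, …, a - 1 gives an a-set A lying in a fraction (km)^-a of F; two
-- members containing A whose intersection has size in L then meet in at least b points.  Colour the vertices with Q ≈ m
-- colours so that for half of these members G the colours on G are distinct and differ from those of the cover vertices,
-- outside G, of all T ⊆ G.  Finally keep only colour sets pairwise meeting in fewer than b colours, which costs a factor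
-- Q^(k-b).  If G and H are kept and |G ∩ H| ∈ L, then they have the same colour set, and a vertex of H in the cover of
-- G ∩ H has the colour of some vertex of G: a contradiction.
--
-- Tightness.  A member is a tuple of vertices, each recording some coordinates of a point (x , y).  There are (k - b) + a
-- coordinates x_c with m - 1 values, and a coordinate y_c with very many values for each c > b outside L.  What a vertex
-- records is chosen so that kernels of m-petal sunflowers have sizes outside L, whereas two typical points of an
-- L-avoiding subfamily with equal y and distinct x would produce an intersection of size in L.

open import Defs
open import Data.Nat using (ℕ; zero; suc; _≤_; _<_; _+_; _∸_; _*_; _^_; z≤n; s≤s; s≤s⁻¹; _≤?_; _<?_; _≟_)
open import Data.Nat.Properties
open import Data.Nat.Induction using (<-rec)
import Data.Nat as ℕ using (NonZero; >-nonZero)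
open import Data.Nat.Tactic.RingSolver using (solve-∀)
import Data.Integer as ℤ using (+_; +≤+)
import Data.Integer.Properties as ℤ
open import Data.Bool using (_∧_)
open import Data.Bool.Properties using () renaming (_≟_ to _≟ᵇ_)
open import Data.Fin using (Fin; zero; suc; fromℕ<)
import Data.Fin.Properties as Fin
open import Data.Fin.Subset using (Subset; inside; outside; _∩_; _∪_; _─_; _-_; ⁅_⁆; ⊥; ⋂; ⋃; ∣_∣; _⊆_)
  renaming (_∈_ to _∈ₛ_; _∉_ to _∉ₛ_)
open import Data.Fin.Subset.Properties renaming (_∈?_ to _∈ₛ?_; _⊆?_ to _⊆ₛ?_)
open import Data.List using (List; []; _∷_; _++_; length; map; filter; concatMap; tabulate; cartesianProductWith; cartesianProduct; upTo; allFin)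
open import Data.List.Properties using (length-map; length-++; length-filter; length-tabulate; length-upTo; filter-none; filter-notAll; filter-all; filter-some; filter-++)
open import Data.List.Membership.Propositional using (_∈_; _∉_; find; lose)
open import Data.List.Membership.Propositional.Properties
open import Data.List.Membership.DecPropositional _≟_ using (_∈?_)
open import Data.List.Relation.Unary.All as All using (All; []; _∷_)
import Data.List.Relation.Unary.All.Properties as All
open import Data.List.Relation.Unary.Any as Any using (Any; here; there; any?)
open import Data.List.Relation.Unary.AllPairs as AllPairs using (AllPairs; []; _∷_)
import Data.List.Relation.Unary.AllPairs.Properties as AllPairs
open import Data.List.Relation.Unary.Unique.Propositional using (Unique)
import Data.List.Relation.Unary.Unique.Propositional.Properties as Unique
open import Data.Product using (Σ; ∃; _×_; _,_; proj₁; proj₂)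
open import Data.Rational using (ℚ; 0ℚ) renaming (_≤_ to _≤ℚ_; _<_ to _<ℚ_; _*_ to _*ℚ_)
import Data.Rational as ℚ
import Data.Rational.Properties as ℚ
import Data.Rational.Unnormalised as ℚᵘ
import Data.Rational.Unnormalised.Properties as ℚᵘ
open import Data.Sum using (_⊎_; inj₁; inj₂; [_,_]′)
open import Data.Vec using (Vec; []; _∷_; here; there) renaming (_++_ to _++ᵥ_)
open import Data.Vec.Properties using (≡-dec; ++-injectiveˡ; ++-injectiveʳ; zipWith-++; ∷-injective)
import Data.Empty as Empty using (⊥)
open import Function using (_∘_; id)
open import Level using (Level)
open import Relation.Nullary using (¬_; Dec; yes; no; ¬?; contradiction)
open import Relation.Nullary.Decidable using (_×-dec_; _⊎-dec_; _→-dec_; decidable-stable)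
open import Relation.Unary using (Pred; Decidable)
open import Relation.Binary using (DecidableEquality; Tri; tri<; tri≈; tri>)
open import Relation.Binary.PropositionalEquality using (_≡_; _≢_; refl; sym; trans; cong; cong₂; subst; subst₂; module ≡-Reasoning)

-- The exponent a + (k - b) has two sources. Passing to the core costs m^a. Making colour sets meet
-- in fewer than b colours costs m^(k-b), since a colour set meeting a given one in b or more is a
-- part of that set plus at most k - b further colours. Per member at most P pairs must receive
-- different colours, with P linear in m, so 2P + 1 colours spoil at most half of the members. A
-- greedy colouring replaces a random one, and all counts stay in ℕ.
--
-- For tightness, the small x-ranges make two petals share any given x-coordinate, and the vertices
-- are arranged so that such sharing spreads through the kernel one vertex at a time. It can stop
-- only at b - 1, at an index outside L where y starts to vary, or at k. Conversely, altering y at a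
-- single index hi destroys agreement at every vertex from hi on. This trims the agreement of two
-- points to an initial segment, possibly with one further vertex, and the point of the design is
-- that its size lies in L. The two demands conflict, which is why roots and the indices in L are
-- recorded by different vertices.

private variable
  ℓ ℓ′ ℓ″ : Level
  A B : Set
  n : ℕ

-- Counting in lists

# : {P : Pred A ℓ} → Decidable P → List A → ℕ
# P? xs = length (filter P? xs)

#-complement : {P : Pred A ℓ} (P? : Decidable P) (xs : List A) → length xs ≡ # P? xs + # (¬? ∘ P?) xs
#-complement P? []       = refl
#-complement P? (x ∷ xs) with P? x
... | yes _ = cong suc (#-complement P? xs)
... | no  _ = trans (cong suc (#-complement P? xs)) (sym (+-suc _ _))

#-≤-+ : {P : Pred A ℓ} {Q : Pred A ℓ′} {R : Pred A ℓ″}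
  (P? : Decidable P) (Q? : Decidable Q) (R? : Decidable R) (xs : List A) →
  (∀ {x} → x ∈ xs → P x → Q x ⊎ R x) → # P? xs ≤ # Q? xs + # R? xs
#-≤-+ P? Q? R? []       imp = z≤n
#-≤-+ P? Q? R? (x ∷ xs) imp with ih ← #-≤-+ P? Q? R? xs (imp ∘ there) | P? x | Q? x | R? x
... | no  _ | no  _ | no  _ = ih
... | no  _ | no  _ | yes _ = ≤-trans ih (+-monoʳ-≤ _ (n≤1+n _))
... | no  _ | yes _ | no  _ = m≤n⇒m≤1+n ih
... | no  _ | yes _ | yes _ = m≤n⇒m≤1+n (≤-trans ih (+-monoʳ-≤ _ (n≤1+n _)))
... | yes _ | yes _ | no  _ = s≤s ih
... | yes _ | yes _ | yes _ = s≤s (≤-trans ih (+-monoʳ-≤ _ (n≤1+n _)))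
... | yes _ | no  _ | yes _ = ≤-trans (s≤s ih) (≤-reflexive (sym (+-suc _ _)))
... | yes p | no ¬q | no ¬r = [ (λ q → contradiction q ¬q) , (λ r → contradiction r ¬r) ]′ (imp (here refl) p)

#-mono : {P : Pred A ℓ} {Q : Pred A ℓ′} (P? : Decidable P) (Q? : Decidable Q) (xs : List A) →
  (∀ {x} → x ∈ xs → P x → Q x) → # P? xs ≤ # Q? xs
#-mono P? Q? []       imp = z≤n
#-mono P? Q? (x ∷ xs) imp with ih ← #-mono P? Q? xs (imp ∘ there) | P? x | Q? x
... | no  _ | no  _ = ih
... | no  _ | yes _ = m≤n⇒m≤1+n ih
... | yes _ | yes _ = s≤s ih
... | yes p | no ¬q = contradiction (imp (here refl) p) ¬q

#-disjoint : {P : Pred A ℓ} {Q : Pred A ℓ′} {R : Pred A ℓ″}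
  (P? : Decidable P) (Q? : Decidable Q) (R? : Decidable R) (xs : List A) →
  (∀ {x} → P x → ¬ Q x) → (∀ {x} → P x → R x) → (∀ {x} → Q x → R x) → # P? xs + # Q? xs ≤ # R? xs
#-disjoint P? Q? R? []       d pr qr = z≤n
#-disjoint P? Q? R? (x ∷ xs) d pr qr with ih ← #-disjoint P? Q? R? xs d pr qr | P? x | Q? x | R? x
... | yes p | yes q | _     = contradiction q (d p)
... | yes p | no  _ | no ¬r = contradiction (pr p) ¬r
... | no  _ | yes q | no ¬r = contradiction (qr q) ¬r
... | yes _ | no  _ | yes _ = s≤s ih
... | no  _ | yes _ | yes _ = ≤-trans (≤-reflexive (+-suc _ _)) (s≤s ih)
... | no  _ | no  _ | yes _ = m≤n⇒m≤1+n ih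
... | no  _ | no  _ | no  _ = ih

#-filter : {P : Pred A ℓ} {Q : Pred A ℓ′} (P? : Decidable P) (Q? : Decidable Q) (xs : List A) →
  # P? (filter Q? xs) ≤ # P? xs
#-filter P? Q? []       = z≤n
#-filter P? Q? (x ∷ xs) with Q? x
... | no  _ = ≤-trans (#-filter P? Q? xs) tail≤
  where
  tail≤ : # P? xs ≤ # P? (x ∷ xs)
  tail≤ with P? x
  ... | yes _ = n≤1+n _
  ... | no  _ = ≤-refl
... | yes _ with P? x
...   | yes _ = s≤s (#-filter P? Q? xs)
...   | no  _ = #-filter P? Q? xs

#-filter-≥ : {P : Pred A ℓ} {Q : Pred A ℓ′} (P? : Decidable P) (Q? : Decidable Q) (xs : List A) →
  (∀ {x} → P x → Q x) → # P? xs ≤ # P? (filter Q? xs)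
#-filter-≥ P? Q? []       imp = z≤n
#-filter-≥ P? Q? (x ∷ xs) imp with Q? x
... | yes _ with P? x
...   | yes _ = s≤s (#-filter-≥ P? Q? xs imp)
...   | no  _ = #-filter-≥ P? Q? xs imp
#-filter-≥ P? Q? (x ∷ xs) imp | no ¬q with P? x
...   | yes p = contradiction (imp p) ¬q
...   | no  _ = #-filter-≥ P? Q? xs imp

Unique-⊆⇒length≤ : {xs ys : List A} → Unique xs → (∀ {x} → x ∈ xs → x ∈ ys) → length xs ≤ length ys
Unique-⊆⇒length≤ []            _   = z≤n
Unique-⊆⇒length≤ {ys = ys} (_∷_ {x} {xs} x≢ uniq) sub with ∈-∃++ (sub (here refl))
... | as , bs , refl = ≤-trans (s≤s (Unique-⊆⇒length≤ uniq sub′)) (≤-reflexive len)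
  where
  sub′ : ∀ {z} → z ∈ xs → z ∈ as ++ bs
  sub′ z∈ with ∈-++⁻ as (sub (there z∈))
  ... | inj₁ p           = ∈-++⁺ˡ p
  ... | inj₂ (here refl) = contradiction refl (All.lookup x≢ z∈)
  ... | inj₂ (there p)   = ∈-++⁺ʳ as p
  len : suc (length (as ++ bs)) ≡ length (as ++ x ∷ bs)
  len rewrite length-++ as {bs} | length-++ as {x ∷ bs} = sym (+-suc _ _)

Unique-map : {f : A → B} {xs : List A} → (∀ {x y} → x ∈ xs → y ∈ xs → f x ≡ f y → x ≡ y) →
  Unique xs → Unique (map f xs)
Unique-map inj []          = []
Unique-map inj (x≢ ∷ uniq) =
  All.map⁺ (All.tabulate (λ y∈ eq → All.lookup x≢ y∈ (inj (here refl) (there y∈) eq)))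
  ∷ Unique-map (λ x∈ y∈ → inj (there x∈) (there y∈)) uniq

length-concatMap : (f : A → List B) (xs : List A) (c : ℕ) → (∀ {x} → x ∈ xs → length (f x) ≤ c) →
  length (concatMap f xs) ≤ length xs * c
length-concatMap f []       c bd = z≤n
length-concatMap f (x ∷ xs) c bd = begin
  length (f x ++ concatMap f xs)            ≡⟨ length-++ (f x) ⟩
  length (f x) + length (concatMap f xs)    ≤⟨ +-mono-≤ (bd (here refl)) (length-concatMap f xs c (bd ∘ there)) ⟩
  c + length xs * c                         ∎
  where open ≤-Reasoning

length-cartesianProductWith : {C : Set} (f : A → B → C) (xs : List A) (ys : List B) →
  length (cartesianProductWith f xs ys) ≡ length xs * length ys
length-cartesianProductWith f []       ys = refl
length-cartesianProductWith f (x ∷ xs) ys = trans (length-++ (map (f x) ys))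
  (cong₂ _+_ (length-map (f x) ys) (length-cartesianProductWith f xs ys))

-- Compare `u` with the best candidate for the elements that `u` misses: the larger of the two
-- counts, times the number of candidates, covers both portions. The alternative `xs ≡ []` accounts
-- for an empty `us`.
pigeonhole : {R : A → B → Set} (R? : ∀ a → Decidable (R a)) (us : List A) (xs : List B) →
  (∀ {x} → x ∈ xs → ∃ λ u → u ∈ us × R u x) →
  xs ≡ [] ⊎ ∃ λ u → u ∈ us × length xs ≤ length us * # (R? u) xs
pigeonhole R? []       []       hit = inj₁ refl
pigeonhole R? []       (x ∷ xs) hit with () ← proj₁ (proj₂ (hit (here refl)))
pigeonhole {R = R} R? (u ∷ us) xs hit =
  inj₂ (combine (pigeonhole R? us rest hit′))
  where
  open ≤-Reasoning
  rest = filter (¬? ∘ R? u) xs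
  hit′ : ∀ {x} → x ∈ rest → ∃ λ v → v ∈ us × R v x
  hit′ x∈ with ∈-filter⁻ (¬? ∘ R? u) x∈
  ... | x∈xs , ¬r with hit x∈xs
  ...   | _ , here refl , r = contradiction r ¬r
  ...   | v , there v∈  , r = v , v∈ , r
  combine : rest ≡ [] ⊎ (∃ λ v → v ∈ us × length rest ≤ length us * # (R? v) rest) →
    ∃ λ v → v ∈ u ∷ us × length xs ≤ length (u ∷ us) * # (R? v) xs
  combine (inj₁ empty) = u , here refl , (begin
    length xs                   ≡⟨ #-complement (R? u) xs ⟩
    # (R? u) xs + length rest   ≡⟨ cong (λ l → # (R? u) xs + length l) empty ⟩
    # (R? u) xs + 0             ≤⟨ +-monoʳ-≤ _ z≤n ⟩
    suc (length us) * # (R? u) xs ∎)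
  combine (inj₂ (v , v∈ , le)) with ≤-total (# (R? u) xs) (# (R? v) xs)
  ... | inj₁ u≤v = v , there v∈ , (begin
    length xs                                  ≡⟨ #-complement (R? u) xs ⟩
    # (R? u) xs + length rest                  ≤⟨ +-mono-≤ u≤v le ⟩
    # (R? v) xs + length us * # (R? v) rest    ≤⟨ +-monoʳ-≤ _ (*-monoʳ-≤ (length us) (#-filter (R? v) _ xs)) ⟩
    suc (length us) * # (R? v) xs              ∎)
  ... | inj₂ v≤u = u , here refl , (begin
    length xs                                  ≡⟨ #-complement (R? u) xs ⟩
    # (R? u) xs + length rest                  ≤⟨ +-monoʳ-≤ _ le ⟩
    # (R? u) xs + length us * # (R? v) rest    ≤⟨ +-monoʳ-≤ _ (*-monoʳ-≤ (length us) (≤-trans (#-filter (R? v) _ xs) v≤u)) ⟩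
    suc (length us) * # (R? u) xs              ∎)

-- Finite subsets as lists

elements : Subset n → List (Fin n)
elements []            = []
elements (inside ∷ p)  = zero ∷ map suc (elements p)
elements (outside ∷ p) = map suc (elements p)

length-elements : (p : Subset n) → length (elements p) ≡ ∣ p ∣
length-elements []            = refl
length-elements (inside ∷ p)  = cong suc (trans (length-map suc (elements p)) (length-elements p))
length-elements (outside ∷ p) = trans (length-map suc (elements p)) (length-elements p)

∈-elements⁺ : {p : Subset n} {x : Fin n} → x ∈ₛ p → x ∈ elements p
∈-elements⁺ {p = inside ∷ p}  here      = here refl
∈-elements⁺ {p = inside ∷ p}  (there x) = there (∈-map⁺ suc (∈-elements⁺ x))
∈-elements⁺ {p = outside ∷ p} (there x) = ∈-map⁺ suc (∈-elements⁺ x)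

∈-elements⁻ : {p : Subset n} {x : Fin n} → x ∈ elements p → x ∈ₛ p
∈-elements⁻ {p = inside ∷ p}  (here refl) = here
∈-elements⁻ {p = inside ∷ p}  (there x∈) with ∈-map⁻ suc x∈
... | _ , y∈ , refl = there (∈-elements⁻ y∈)
∈-elements⁻ {p = outside ∷ p} x∈ with ∈-map⁻ suc x∈
... | _ , y∈ , refl = there (∈-elements⁻ y∈)

elements-Unique : (p : Subset n) → Unique (elements p)
elements-Unique []            = []
elements-Unique (inside ∷ p)  =
  All.map⁺ (All.universal (λ _ ()) (elements p)) ∷ Unique.map⁺ Fin.suc-injective (elements-Unique p)
elements-Unique (outside ∷ p) = Unique.map⁺ Fin.suc-injective (elements-Unique p)

∣p∣≡∣p∩q∣+∣p─q∣ : (p q : Subset n) → ∣ p ∣ ≡ ∣ p ∩ q ∣ + ∣ p ─ q ∣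
∣p∣≡∣p∩q∣+∣p─q∣ []            []            = refl
∣p∣≡∣p∩q∣+∣p─q∣ (inside ∷ p)  (inside ∷ q)  = cong suc (∣p∣≡∣p∩q∣+∣p─q∣ p q)
∣p∣≡∣p∩q∣+∣p─q∣ (inside ∷ p)  (outside ∷ q) = trans (cong suc (∣p∣≡∣p∩q∣+∣p─q∣ p q)) (sym (+-suc _ _))
∣p∣≡∣p∩q∣+∣p─q∣ (outside ∷ p) (inside ∷ q)  = ∣p∣≡∣p∩q∣+∣p─q∣ p q
∣p∣≡∣p∩q∣+∣p─q∣ (outside ∷ p) (outside ∷ q) = ∣p∣≡∣p∩q∣+∣p─q∣ p q

p∩q∪p─q≡p : (p q : Subset n) → (p ∩ q) ∪ (p ─ q) ≡ p
p∩q∪p─q≡p []            []            = refl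
p∩q∪p─q≡p (inside ∷ p)  (inside ∷ q)  = cong (inside ∷_) (p∩q∪p─q≡p p q)
p∩q∪p─q≡p (inside ∷ p)  (outside ∷ q) = cong (inside ∷_) (p∩q∪p─q≡p p q)
p∩q∪p─q≡p (outside ∷ p) (inside ∷ q)  = cong (outside ∷_) (p∩q∪p─q≡p p q)
p∩q∪p─q≡p (outside ∷ p) (outside ∷ q) = cong (outside ∷_) (p∩q∪p─q≡p p q)

powerset : Subset n → List (Subset n)
powerset []            = [] ∷ []
powerset (inside ∷ p)  = map (inside ∷_) (powerset p) ++ map (outside ∷_) (powerset p)
powerset (outside ∷ p) = map (outside ∷_) (powerset p)

length-powerset : (p : Subset n) → length (powerset p) ≡ 2 ^ ∣ p ∣
length-powerset []            = refl
length-powerset (inside ∷ p)  = trans (length-++ (map (inside ∷_) (powerset p)))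
  (cong₂ _+_ (trans (length-map _ (powerset p)) (length-powerset p))
             (trans (trans (length-map _ (powerset p)) (length-powerset p)) (sym (+-identityʳ _))))
length-powerset (outside ∷ p) = trans (length-map _ (powerset p)) (length-powerset p)

∈-powerset : {p q : Subset n} → q ⊆ p → q ∈ powerset p
∈-powerset {p = []}          {[]}          q⊆p = here refl
∈-powerset {p = inside ∷ p}  {inside ∷ q}  q⊆p = ∈-++⁺ˡ (∈-map⁺ _ (∈-powerset (drop-∷-⊆ q⊆p)))
∈-powerset {p = inside ∷ p}  {outside ∷ q} q⊆p =
  ∈-++⁺ʳ (map (inside ∷_) (powerset p)) (∈-map⁺ _ (∈-powerset (drop-∷-⊆ q⊆p)))
∈-powerset {p = outside ∷ p} {inside ∷ q}  q⊆p with () ← q⊆p here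
∈-powerset {p = outside ∷ p} {outside ∷ q} q⊆p = ∈-map⁺ _ (∈-powerset (drop-∷-⊆ q⊆p))

-- Each of the s rounds adds one element or none, so sets occur with repetitions; this makes the
-- length exactly `suc n ^ s`, which serves as an upper bound.
boundedSubsets : (n s : ℕ) → List (Subset n)
boundedSubsets n zero    = ⊥ ∷ []
boundedSubsets n (suc s) = boundedSubsets n s ++ cartesianProductWith (λ x p → ⁅ x ⁆ ∪ p) (allFin n) (boundedSubsets n s)

length-allFin : ∀ n → length (allFin n) ≡ n
length-allFin n = length-tabulate {n = n} id

length-boundedSubsets : ∀ n s → length (boundedSubsets n s) ≡ suc n ^ s
length-boundedSubsets n zero    = refl
length-boundedSubsets n (suc s) = trans (length-++ (boundedSubsets n s))
  (cong₂ _+_ (length-boundedSubsets n s)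
    (trans (length-cartesianProductWith _ (allFin n) (boundedSubsets n s))
           (cong₂ _*_ (length-allFin n) (length-boundedSubsets n s))))

∈-boundedSubsets : ∀ {s} {p : Subset n} → ∣ p ∣ ≤ s → p ∈ boundedSubsets n s
∈-boundedSubsets {n} {s} {p} p≤s with nonempty? p
... | no empty rewrite Empty-unique empty = ⊥∈boundedSubsets s
  where
  ⊥∈boundedSubsets : ∀ s → ⊥ ∈ boundedSubsets n s
  ⊥∈boundedSubsets zero    = here refl
  ⊥∈boundedSubsets (suc s) = ∈-++⁺ˡ (⊥∈boundedSubsets s)
∈-boundedSubsets {n} {zero}  {p} p≤s | yes (x , x∈p) = contradiction (≤-trans (x∈p⇒∣p-x∣<∣p∣ x∈p) p≤s) (λ ())
∈-boundedSubsets {n} {suc s} {p} p≤s | yes (x , x∈p) =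
  ∈-++⁺ʳ (boundedSubsets n s) (subst (_∈ _) eq
    (∈-cartesianProductWith⁺ (λ x p → ⁅ x ⁆ ∪ p) (∈-allFin x)
      (∈-boundedSubsets (s≤s⁻¹ (≤-trans (x∈p⇒∣p-x∣<∣p∣ x∈p) p≤s)))))
  where
  eq : ⁅ x ⁆ ∪ (p - x) ≡ p
  eq = ⊆-antisym
    (λ y∈ → [ (λ y∈x → subst (_∈ₛ p) (sym (x∈⁅y⁆⇒x≡y x y∈x)) x∈p) , p─q⊆p p ⁅ x ⁆ ]′ (x∈p∪q⁻ _ _ y∈))
    (λ {y} y∈ → go y y∈ (y Fin.≟ x))
    where
    go : ∀ y → y ∈ₛ p → Dec (y ≡ x) → y ∈ₛ ⁅ x ⁆ ∪ (p - x)
    go y y∈ (yes refl) = x∈p∪q⁺ (inj₁ (x∈⁅x⁆ x))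
    go y y∈ (no y≢x)   = x∈p∪q⁺ (inj₂ (x∈p∧x≢y⇒x∈p-y y∈ y≢x))

image : {q : ℕ} → (Fin n → Fin q) → Subset n → Subset q
image χ p = ⋃ (map (⁅_⁆ ∘ χ) (elements p))

∈-image⁺ : {q : ℕ} (χ : Fin n → Fin q) {p : Subset n} {x : Fin n} → x ∈ₛ p → χ x ∈ₛ image χ p
∈-image⁺ {n} χ {p} x∈p = go (∈-elements⁺ x∈p)
  where
  go : ∀ {x xs} → x ∈ xs → χ x ∈ₛ ⋃ (map (⁅_⁆ ∘ χ) xs)
  go (here refl) = x∈p∪q⁺ (inj₁ (x∈⁅x⁆ _))
  go (there x∈)  = x∈p∪q⁺ (inj₂ (go x∈))

∈-image⁻ : {q : ℕ} (χ : Fin n → Fin q) {p : Subset n} {c : Fin q} → c ∈ₛ image χ p →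
  ∃ λ x → x ∈ₛ p × c ≡ χ x
∈-image⁻ {n} χ {p} c∈ with go (elements p) c∈
  where
  go : ∀ xs {c} → c ∈ₛ ⋃ (map (⁅_⁆ ∘ χ) xs) → ∃ λ x → x ∈ xs × c ≡ χ x
  go []       c∈ = contradiction c∈ ∉⊥
  go (x ∷ xs) c∈ with x∈p∪q⁻ ⁅ χ x ⁆ _ c∈
  ... | inj₁ c∈x = x , here refl , x∈⁅y⁆⇒x≡y _ c∈x
  ... | inj₂ c∈r with go xs c∈r
  ...   | y , y∈ , eq = y , there y∈ , eq
... | x , x∈ , eq = x , ∈-elements⁻ x∈ , eq

∣image∣≤ : {q : ℕ} (χ : Fin n → Fin q) (p : Subset n) → ∣ image χ p ∣ ≤ ∣ p ∣
∣image∣≤ χ p = begin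
  ∣ image χ p ∣                   ≡⟨ length-elements (image χ p) ⟨
  length (elements (image χ p))   ≤⟨ Unique-⊆⇒length≤ (elements-Unique (image χ p)) sub ⟩
  length (map χ (elements p))     ≡⟨ length-map χ (elements p) ⟩
  length (elements p)             ≡⟨ length-elements p ⟩
  ∣ p ∣                           ∎
  where
  open ≤-Reasoning
  sub : ∀ {c} → c ∈ elements (image χ p) → c ∈ map χ (elements p)
  sub c∈ with ∈-image⁻ χ {p} (∈-elements⁻ c∈)
  ... | x , x∈ , refl = ∈-map⁺ χ (∈-elements⁺ x∈)

injective⇒∣∣≤ : {q : ℕ} (χ : Fin n → Fin q) (p : Subset n) (r : Subset q) →
  (∀ {x} → x ∈ₛ p → χ x ∈ₛ r) → (∀ {x y} → x ∈ₛ p → y ∈ₛ p → χ x ≡ χ y → x ≡ y) → ∣ p ∣ ≤ ∣ r ∣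
injective⇒∣∣≤ χ p r into inj = begin
  ∣ p ∣                         ≡⟨ length-elements p ⟨
  length (elements p)           ≡⟨ length-map χ (elements p) ⟨
  length (map χ (elements p))   ≤⟨ Unique-⊆⇒length≤
                                     (Unique-map (λ x∈ y∈ → inj (∈-elements⁻ x∈) (∈-elements⁻ y∈)) (elements-Unique p)) sub ⟩
  length (elements r)           ≡⟨ length-elements r ⟩
  ∣ r ∣                         ∎
  where
  open ≤-Reasoning
  sub : ∀ {c} → c ∈ map χ (elements p) → c ∈ elements r
  sub c∈ with ∈-map⁻ χ c∈
  ... | x , x∈ , refl = ∈-elements⁺ (into (∈-elements⁻ x∈))

-- Covers of links

_≟ₛ_ : DecidableEquality (Subset n)
_≟ₛ_ = ≡-dec _≟ᵇ_

Covers : Subset n → List (Fin n) → List (Subset n) → Set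
Covers T U Fs = All (_∉ₛ T) U × (∀ {F} → F ∈ Fs → ∃ λ u → u ∈ U × u ∈ₛ F)

-- A maximal family of sets meeting pairwise exactly in T has either m members, or the vertices of its members cover.
petals⊎cover : ∀ {k} (T : Subset n) m (Fs : List (Subset n)) →
  (∀ {F} → F ∈ Fs → ∣ F ∣ ≡ k × T ⊆ F) →
  (Σ (Fin m → Subset n) λ S → (∀ i → S i ∈ Fs) × (∀ i j → i ≢ j → S i ∩ S j ≡ T))
  ⊎ (Σ (List (Fin n)) λ U → length U ≤ m * k × Covers T U Fs)
petals⊎cover T zero    Fs       hyp = inj₁ ((λ ()) , (λ ()) , λ ())
petals⊎cover T (suc m) []       hyp = inj₂ ([] , z≤n , [] , λ ())
petals⊎cover {n} {k} T (suc m) (F₀ ∷ Fs) hyp =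
  extend (petals⊎cover T m rest (hyp ∘ proj₁ ∘ ∈-filter⁻ meets?))
  where
  meets? : Decidable (λ G → F₀ ∩ G ≡ T)
  meets? G = (F₀ ∩ G) ≟ₛ T
  -- `F₀` itself stays in `rest` when it equals `T`, so petals may repeat at this stage; the
  -- recursion is on `m`, not on the list.
  rest = filter meets? (F₀ ∷ Fs)
  new = elements (F₀ ─ T)
  F₀-k = proj₁ (hyp (here refl))
  surplus : ∀ {G} → G ∈ F₀ ∷ Fs → F₀ ∩ G ≢ T → ∃ λ x → x ∈ₛ F₀ ∩ G × x ∉ₛ T
  surplus {G} G∈ ≢T with Fin.any? (λ x → (x ∈ₛ? (F₀ ∩ G)) ×-dec ¬? (x ∈ₛ? T))
  ... | yes found = found
  ... | no  none  = contradiction (⊆-antisym ⊆T ⊇T) ≢T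
    where
    ⊆T : F₀ ∩ G ⊆ T
    ⊆T {x} x∈ with x ∈ₛ? T
    ... | yes x∈T = x∈T
    ... | no  x∉T = contradiction (x , x∈ , x∉T) none
    ⊇T : T ⊆ F₀ ∩ G
    ⊇T x∈T = x∈p∩q⁺ (proj₂ (hyp (here refl)) x∈T , proj₂ (hyp G∈) x∈T)
  extend : _ → _
  extend (inj₁ (S , S∈ , S∩)) = inj₁ (S′ , S′∈ , S′∩)
    where
    S′ : Fin (suc m) → Subset n
    S′ zero    = F₀
    S′ (suc i) = S i
    S′∈ : ∀ i → S′ i ∈ F₀ ∷ Fs
    S′∈ zero    = here refl
    S′∈ (suc i) = proj₁ (∈-filter⁻ meets? (S∈ i))
    S′∩ : ∀ i j → i ≢ j → S′ i ∩ S′ j ≡ T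
    S′∩ zero    zero    i≢j = contradiction refl i≢j
    S′∩ zero    (suc j) i≢j = proj₂ (∈-filter⁻ meets? {xs = F₀ ∷ Fs} (S∈ j))
    S′∩ (suc i) zero    i≢j = trans (∩-comm (S i) F₀) (proj₂ (∈-filter⁻ meets? {xs = F₀ ∷ Fs} (S∈ i)))
    S′∩ (suc i) (suc j) i≢j = S∩ i j (i≢j ∘ cong suc)
  extend (inj₂ (U , U≤ , U∉T , hit)) = inj₂ (new ++ U , len , All.++⁺ new∉T U∉T , λ {F} → hit′ {F})
    where
    open ≤-Reasoning
    len : length (new ++ U) ≤ k + m * k
    len = begin
      length (new ++ U)          ≡⟨ length-++ new ⟩
      length new + length U      ≡⟨ cong (_+ length U) (length-elements (F₀ ─ T)) ⟩
      ∣ F₀ ─ T ∣ + length U      ≤⟨ +-mono-≤ (∣p─q∣≤∣p∣ F₀ T) U≤ ⟩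
      ∣ F₀ ∣ + m * k             ≡⟨ cong (_+ m * k) F₀-k ⟩
      k + m * k                  ∎
    new∉T : All (_∉ₛ T) new
    new∉T = All.tabulate (λ x∈ x∈T → p─q-∉ F₀ T (∈-elements⁻ x∈) x∈T)
      where
      p─q-∉ : ∀ {n} (p q : Subset n) {x} → x ∈ₛ p ─ q → x ∉ₛ q
      p─q-∉ (_ ∷ p) (inside ∷ q)  (there x∈) (there x∈q) = p─q-∉ p q x∈ x∈q
      p─q-∉ (_ ∷ p) (outside ∷ q) (there x∈) (there x∈q) = p─q-∉ p q x∈ x∈q
    into-new : ∀ {x} → x ∈ₛ F₀ → x ∉ₛ T → x ∈ new ++ U
    into-new x∈F₀ x∉T = ∈-++⁺ˡ (∈-elements⁺ (x∈p∧x∉q⇒x∈p─q x∈F₀ x∉T))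
    hit′ : ∀ {F} → F ∈ F₀ ∷ Fs → ∃ λ u → u ∈ new ++ U × u ∈ₛ F
    hit′ {F} F∈ with meets? F
    ... | yes ≡T with hit (∈-filter⁺ meets? F∈ ≡T)
    ...   | u , u∈U , u∈F = u , ∈-++⁺ʳ new u∈U , u∈F
    hit′ {F} F∈ | no ≢T with surplus F∈ ≢T
    ...   | x , x∈ , x∉T = let x∈F₀ , x∈F = x∈p∩q⁻ F₀ F x∈ in x , into-new x∈F₀ x∉T , x∈F

⋂-⊆ : {p : Subset n} {ps : List (Subset n)} → p ∈ ps → ⋂ ps ⊆ p
⋂-⊆ {ps = q ∷ ps} (here refl) x∈ = proj₁ (x∈p∩q⁻ q (⋂ ps) x∈)
⋂-⊆ {ps = q ∷ ps} (there p∈)  x∈ = ⋂-⊆ p∈ (proj₂ (x∈p∩q⁻ q (⋂ ps) x∈))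

⊆-⋂ : {T : Subset n} {ps : List (Subset n)} → (∀ {p} → p ∈ ps → T ⊆ p) → T ⊆ ⋂ ps
⊆-⋂ {ps = []}     T⊆ x∈ = ∈⊤
⊆-⋂ {ps = q ∷ ps} T⊆ x∈ = x∈p∩q⁺ (T⊆ (here refl) x∈ , ⊆-⋂ (T⊆ ∘ there) x∈)

-- Two equal petals would meet in themselves and so have the size of `T`, which the strict
-- inequality excludes. With two petals available, the kernel is squeezed between `T` and the
-- intersection of the first two.
petals⇒sunflower : ∀ {m} {T : Subset n} (S : Fin m → Subset n) → 2 ≤ m → (∀ i → ∣ T ∣ < ∣ S i ∣) →
  (∀ i j → i ≢ j → S i ∩ S j ≡ T) → IsSunflower S × kernel S ≡ T
petals⇒sunflower {m = suc (suc m)} {T} S (s≤s (s≤s _)) T<S S∩ =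
  (injective , λ i j i≢j → trans (S∩ i j i≢j) (sym kernel≡T)) , kernel≡T
  where
  injective : ∀ {i j} → S i ≡ S j → i ≡ j
  injective {i} {j} eq with i Fin.≟ j
  ... | yes i≡j = i≡j
  ... | no  i≢j = contradiction (T<S i)
    (subst (λ p → ¬ ∣ T ∣ < ∣ p ∣) (trans (sym (S∩ i j i≢j)) (trans (cong (S i ∩_) (sym eq)) (∩-idem (S i)))) (n≮n _))
  T⊆S : ∀ i → T ⊆ S i
  T⊆S zero    = subst (_⊆ S zero) (S∩ zero (suc zero) (λ ())) (p∩q⊆p _ _)
  T⊆S (suc i) = subst (_⊆ S (suc i)) (S∩ (suc i) zero (λ ())) (p∩q⊆p _ _)
  kernel≡T : kernel S ≡ T
  kernel≡T = ⊆-antisym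
    (λ x∈ → subst (_ ∈ₛ_) (S∩ zero (suc zero) (λ ()))
      (x∈p∩q⁺ (⋂-⊆ (∈-tabulate⁺ {f = S} zero) x∈ , ⋂-⊆ (∈-tabulate⁺ {f = S} (suc zero)) x∈)))
    (⊆-⋂ {ps = tabulate S} λ p∈ → let i , eq = ∈-tabulate⁻ {f = S} p∈ in subst (T ⊆_) (sym eq) (T⊆S i))

noSunflower⇒cover : ∀ {k m L} (Fs : Family n) → 2 ≤ m → Uniform k Fs → ¬ HasLSunflower L m Fs →
  (T : Subset n) → ∣ T ∣ ∈ L → ∣ T ∣ < k →
  Σ (List (Fin n)) λ U → length U ≤ m * k × Covers T U (filter (T ⊆ₛ?_) Fs)
noSunflower⇒cover {k = k} {m} {L} Fs 2≤m unif none T T∈L T<k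
  with petals⊎cover T m (filter (T ⊆ₛ?_) Fs) hyp
  where
  hyp : ∀ {F} → F ∈ filter (T ⊆ₛ?_) Fs → ∣ F ∣ ≡ k × T ⊆ F
  hyp F∈ = let F∈Fs , T⊆F = ∈-filter⁻ (T ⊆ₛ?_) {xs = Fs} F∈ in All.lookup unif F∈Fs , T⊆F
... | inj₂ cover         = cover
... | inj₁ (S , S∈ , S∩) = contradiction (S , sunflower , S∈Fs , subst (λ K → ∣ K ∣ ∈ L) (sym ker) T∈L) none
  where
  S∈Fs : ∀ i → S i ∈ Fs
  S∈Fs i = proj₁ (∈-filter⁻ (T ⊆ₛ?_) {xs = Fs} (S∈ i))
  both = petals⇒sunflower S 2≤m (λ i → subst (∣ T ∣ <_) (sym (All.lookup unif (S∈Fs i))) T<k) S∩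
  sunflower = proj₁ both
  ker = proj₂ both

-- Colourings with few monochromatic pairs


-- Distinct colours have disjoint classes, so discarding the class of `c` leaves the other classes
-- intact. The rarest of these in the remainder is compared with `c`, and the smaller class is at
-- most the average.
rarest : (_≟′_ : DecidableEquality A) (c : A) (cs : List A) → Unique (c ∷ cs) → (xs : List A) →
  ∃ λ d → d ∈ c ∷ cs × length (c ∷ cs) * # (d ≟′_) xs ≤ length xs
rarest _≟′_ c []       uniq       xs = c , here refl , ≤-trans (≤-reflexive (+-identityʳ _)) (length-filter (c ≟′_) xs)
rarest _≟′_ c (e ∷ cs) (c≢ ∷ uniq) xs = choose (rarest _≟′_ e cs uniq rest)
  where
  open ≤-Reasoning
  rest = filter (¬? ∘ (c ≟′_)) xs
  choose : (∃ λ d → d ∈ e ∷ cs × length (e ∷ cs) * # (d ≟′_) rest ≤ length rest) →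
    ∃ λ d → d ∈ c ∷ e ∷ cs × length (c ∷ e ∷ cs) * # (d ≟′_) xs ≤ length xs
  choose (d , d∈ , le) with ≤-total (# (c ≟′_) xs) (# (d ≟′_) xs)
                          | #-filter-≥ (d ≟′_) (¬? ∘ (c ≟′_)) xs (λ d≡x c≡x → All.lookup c≢ d∈ (trans c≡x (sym d≡x)))
  ... | inj₁ c≤d | d≤ = c , here refl , (begin
    # (c ≟′_) xs + length (e ∷ cs) * # (c ≟′_) xs    ≤⟨ +-monoʳ-≤ (# (c ≟′_) xs) (*-monoʳ-≤ (length (e ∷ cs)) (≤-trans c≤d d≤)) ⟩
    # (c ≟′_) xs + length (e ∷ cs) * # (d ≟′_) rest  ≤⟨ +-monoʳ-≤ _ le ⟩
    # (c ≟′_) xs + length rest                       ≡⟨ #-complement (c ≟′_) xs ⟨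
    length xs                                        ∎)
  ... | inj₂ d≤c | d≤ = d , there d∈ , (begin
    # (d ≟′_) xs + length (e ∷ cs) * # (d ≟′_) xs    ≤⟨ +-mono-≤ d≤c (*-monoʳ-≤ (length (e ∷ cs)) d≤) ⟩
    # (c ≟′_) xs + length (e ∷ cs) * # (d ≟′_) rest  ≤⟨ +-monoʳ-≤ _ le ⟩
    # (c ≟′_) xs + length rest                       ≡⟨ #-complement (c ≟′_) xs ⟨
    length xs                                        ∎)

rarest-Fin : ∀ {q} (xs : List (Fin (suc q))) → ∃ λ c → suc q * # (c Fin.≟_) xs ≤ length xs
rarest-Fin {q} xs with rarest Fin._≟_ zero (tabulate suc) (Unique.allFin⁺ (suc q)) xs
... | c , _ , le = c , subst (λ l → l * # (c Fin.≟_) xs ≤ length xs) (length-allFin (suc q)) le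

Monochromatic : {q : ℕ} → (Fin n → Fin q) → Fin n × Fin n → Set
Monochromatic χ (u , v) = χ u ≡ χ v

mono? : {q : ℕ} (χ : Fin n → Fin q) → Decidable (Monochromatic χ)
mono? χ (u , v) = χ u Fin.≟ χ v

-- Colour vertex 0 last, by the colour that is rarest among its neighbours.
∃-colouring : ∀ {q} (es : List (Fin n × Fin n)) → All (λ (u , v) → u ≢ v) es →
  Σ (Fin n → Fin (suc q)) λ χ → suc q * # (mono? χ) es ≤ length es
∃-colouring {zero}  {q} []             _   = (λ ()) , ≤-reflexive (*-zeroʳ q)
∃-colouring {zero}  {q} ((() , _) ∷ _) _
∃-colouring {suc n} {q} es             es≢ = χ , bound
  where
  inner : List (Fin (suc n) × Fin (suc n)) → List (Fin n × Fin n)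
  inner []                       = []
  inner ((suc u , suc v) ∷ es)   = (u , v) ∷ inner es
  inner ((zero  , _) ∷ es)       = inner es
  inner ((suc _ , zero) ∷ es)    = inner es
  inner-≢ : ∀ {es} → All (λ (u , v) → u ≢ v) es → All (λ (u , v) → u ≢ v) (inner es)
  inner-≢ {[]}                       []         = []
  inner-≢ {(suc u , suc v) ∷ es}     (u≢v ∷ ps) = (u≢v ∘ cong suc) ∷ inner-≢ ps
  inner-≢ {(zero  , _) ∷ es}         (_ ∷ ps)   = inner-≢ ps
  inner-≢ {(suc _ , zero) ∷ es}      (_ ∷ ps)   = inner-≢ ps
  neighbours : List (Fin (suc n) × Fin (suc n)) → List (Fin n)
  neighbours []                       = []
  neighbours ((suc u , suc v) ∷ es)   = neighbours es
  neighbours ((zero  , zero) ∷ es)    = neighbours es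
  neighbours ((zero  , suc v) ∷ es)   = v ∷ neighbours es
  neighbours ((suc u , zero) ∷ es)    = u ∷ neighbours es
  ih = ∃-colouring {n} {q} (inner es) (inner-≢ es≢)
  χ′ = proj₁ ih
  new = rarest-Fin (map χ′ (neighbours es))
  c = proj₁ new
  χ : Fin (suc n) → Fin (suc q)
  χ zero    = c
  χ (suc v) = χ′ v
  split : ∀ es → All (λ (u , v) → u ≢ v) es →
    # (mono? χ) es ≡ # (mono? χ′) (inner es) + # (c Fin.≟_) (map χ′ (neighbours es))
  split []                     _        = refl
  split ((suc u , suc v) ∷ es) (_ ∷ ps) with χ′ u Fin.≟ χ′ v
  ... | yes _ = cong suc (split es ps)
  ... | no  _ = split es ps
  split ((zero  , zero) ∷ es)  (p ∷ ps) = contradiction refl p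
  split ((zero  , suc v) ∷ es) (_ ∷ ps) with c Fin.≟ χ′ v
  ... | yes _ = trans (cong suc (split es ps)) (sym (+-suc _ _))
  ... | no  _ = split es ps
  split ((suc u , zero) ∷ es)  (_ ∷ ps) with χ′ u Fin.≟ c | c Fin.≟ χ′ u
  ... | yes _  | yes _  = trans (cong suc (split es ps)) (sym (+-suc _ _))
  ... | no  _  | no  _  = split es ps
  ... | yes eq | no ¬eq = contradiction (sym eq) ¬eq
  ... | no ¬eq | yes eq = contradiction (sym eq) ¬eq
  sizes : ∀ es → All (λ (u , v) → u ≢ v) es → length es ≡ length (inner es) + length (neighbours es)
  sizes []                     _        = refl
  sizes ((suc u , suc v) ∷ es) (_ ∷ ps) = cong suc (sizes es ps)
  sizes ((zero  , zero) ∷ es)  (p ∷ ps) = contradiction refl p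
  sizes ((zero  , suc v) ∷ es) (_ ∷ ps) = trans (cong suc (sizes es ps)) (sym (+-suc _ _))
  sizes ((suc u , zero) ∷ es)  (_ ∷ ps) = trans (cong suc (sizes es ps)) (sym (+-suc _ _))
  bound : suc q * # (mono? χ) es ≤ length es
  bound = begin
    suc q * # (mono? χ) es                       ≡⟨ cong (suc q *_) (split es es≢) ⟩
    suc q * (# (mono? χ′) (inner es) + # (c Fin.≟_) (map χ′ (neighbours es)))
                                                 ≡⟨ *-distribˡ-+ (suc q) (# (mono? χ′) (inner es)) _ ⟩
    suc q * # (mono? χ′) (inner es) + suc q * # (c Fin.≟_) (map χ′ (neighbours es))
                                                 ≤⟨ +-mono-≤ (proj₂ ih) (proj₂ new) ⟩
    length (inner es) + length (map χ′ (neighbours es))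
                                                 ≡⟨ cong (length (inner es) +_) (length-map χ′ (neighbours es)) ⟩
    length (inner es) + length (neighbours es)   ≡⟨ sizes es es≢ ⟨
    length es                                    ∎
    where open ≤-Reasoning

-- A greedy weighted independent set

module Select {K : Set} (_≟ₖ_ : DecidableEquality K) (key : A → K) where

  open import Data.List.Membership.DecPropositional _≟ₖ_ using () renaming (_∈?_ to _∈ₖ?_)

  weight : List A → K → ℕ
  weight xs κ = # (λ x → key x ≟ₖ κ) xs

  weight-∈ : (xs : List A) (w : ℕ) → (∀ κ → weight xs κ ≤ w) → ∀ κs → # (λ x → key x ∈ₖ? κs) xs ≤ length κs * w
  weight-∈ xs w ≤w []       = ≤-reflexive (none xs)
    where
    none : ∀ xs → # (λ x → key x ∈ₖ? []) xs ≡ 0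
    none []       = refl
    none (x ∷ xs) = none xs
  weight-∈ xs w ≤w (κ ∷ κs) = ≤-trans
    (#-≤-+ (λ x → key x ∈ₖ? (κ ∷ κs)) (λ x → key x ≟ₖ κ) (λ x → key x ∈ₖ? κs) xs
      (λ { _ (here eq) → inj₁ eq ; _ (there ∈κs) → inj₂ ∈κs }))
    (+-mono-≤ (≤w κ) (weight-∈ xs w ≤w κs))

  heaviest : (x : A) (xs : List A) → ∃ λ y → y ∈ x ∷ xs × (∀ κ → weight (x ∷ xs) κ ≤ weight (x ∷ xs) (key y))
  heaviest x xs with candidates (x ∷ xs) x
    where
    all = x ∷ xs
    candidates : ∀ ys y₀ → ∃ λ y → y ∈ y₀ ∷ ys × (∀ {z} → z ∈ y₀ ∷ ys → weight all (key z) ≤ weight all (key y))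
    candidates []       y₀ = y₀ , here refl , λ { (here refl) → ≤-refl }
    candidates (y ∷ ys) y₀ with candidates ys y
    ... | v , v∈ , max with ≤-total (weight all (key y₀)) (weight all (key v))
    ...   | inj₁ le = v , there v∈ , λ { (here refl) → le ; (there z∈) → max z∈ }
    ...   | inj₂ ge = y₀ , here refl , λ { (here refl) → ≤-refl ; (there z∈) → ≤-trans (max z∈) ge }
  ... | y , y∈ , max = y , dup y∈ , bound
    where
    dup : ∀ {y} → y ∈ x ∷ x ∷ xs → y ∈ x ∷ xs
    dup (here eq)  = here eq
    dup (there y∈) = y∈
    bound : ∀ κ → weight (x ∷ xs) κ ≤ weight (x ∷ xs) (key y)
    bound κ with any? (λ z → key z ≟ₖ κ) (x ∷ xs)
    ... | no  none  = subst (_≤ _) (sym (cong length (filter-none (λ z → key z ≟ₖ κ) (All.¬Any⇒All¬ _ none)))) z≤n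
    ... | yes found with find found
    ...   | z , z∈ , refl = max (there z∈)

  -- Take the heaviest key, discard all elements whose key is it or one of its at most Δ neighbours,
  -- and repeat: each round discards at most Δ + 1 times the weight it keeps. Only neighbours of the
  -- earlier key are discarded, so independence holds in one direction, depending on which key was
  -- taken first.
  select : (nb : K → List K) (Δ : ℕ) (xs : List A) → (∀ {x} → x ∈ xs → length (nb (key x)) ≤ Δ) →
    Σ (List K) λ κs → (length xs ≤ suc Δ * # (λ x → key x ∈ₖ? κs) xs)
      × (∀ {κ κ′} → κ ∈ κs → κ′ ∈ κs → κ ≡ κ′ ⊎ κ′ ∉ nb κ ⊎ κ ∉ nb κ′)
  select nb Δ xs small = let κs , le , _ , indep = go (length xs) xs ≤-refl small in κs , le , (λ {κ} {κ′} → indep {κ} {κ′})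
    where
    go : ∀ fuel xs → length xs ≤ fuel → (∀ {x} → x ∈ xs → length (nb (key x)) ≤ Δ) →
      Σ (List K) λ κs → (length xs ≤ suc Δ * # (λ x → key x ∈ₖ? κs) xs)
        -- Selected keys occur among the remaining elements; this separates the keys of later rounds
        -- from the neighbours discarded before.
        × (∀ {κ} → κ ∈ κs → ∃ λ x → x ∈ xs × key x ≡ κ)
        × (∀ {κ κ′} → κ ∈ κs → κ′ ∈ κs → κ ≡ κ′ ⊎ κ′ ∉ nb κ ⊎ κ ∉ nb κ′)
    go _          []       _   _     = [] , z≤n , (λ ()) , λ ()
    go (suc fuel) (x ∷ xs) len small = κ ∷ κs , bound , used , indep
      where
      all = x ∷ xs
      top = heaviest x xs
      y = proj₁ top
      y∈ = proj₁ (proj₂ top)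
      κ = key y
      w = weight all κ
      near? : Decidable (λ z → key z ∈ κ ∷ nb κ)
      near? z = key z ∈ₖ? (κ ∷ nb κ)
      rest = filter (¬? ∘ near?) all
      rest< : length rest < length all
      rest< = filter-notAll (¬? ∘ near?) all (lose y∈ (λ ¬near → ¬near (here refl)))
      rec = go fuel rest (s≤s⁻¹ (≤-trans rest< len)) (small ∘ proj₁ ∘ ∈-filter⁻ (¬? ∘ near?) {xs = all})
      κs = proj₁ rec
      far : ∀ {κ′} → κ′ ∈ κs → κ′ ∉ κ ∷ nb κ
      far κ′∈ near with proj₁ (proj₂ (proj₂ rec)) κ′∈
      ... | z , z∈ , refl = proj₂ (∈-filter⁻ (¬? ∘ near?) {xs = all} z∈) near
      used : ∀ {κ′} → κ′ ∈ κ ∷ κs → ∃ λ z → z ∈ all × key z ≡ κ′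
      used (here refl) = y , y∈ , refl
      used (there κ′∈) = let z , z∈ , eq = proj₁ (proj₂ (proj₂ rec)) κ′∈
                         in z , proj₁ (∈-filter⁻ (¬? ∘ near?) {xs = all} z∈) , eq
      indep : ∀ {κ₁ κ₂} → κ₁ ∈ κ ∷ κs → κ₂ ∈ κ ∷ κs → κ₁ ≡ κ₂ ⊎ κ₂ ∉ nb κ₁ ⊎ κ₁ ∉ nb κ₂
      indep (here refl) (here refl) = inj₁ refl
      indep (here refl) (there κ₂∈) = inj₂ (inj₁ (far κ₂∈ ∘ there))
      indep (there κ₁∈) (here refl) = inj₂ (inj₂ (far κ₁∈ ∘ there))
      indep (there κ₁∈) (there κ₂∈) = proj₂ (proj₂ (proj₂ rec)) κ₁∈ κ₂∈
      in-κs : List A → ℕ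
      in-κs = # (λ z → key z ∈ₖ? κs)
      bound : length all ≤ suc Δ * # (λ z → key z ∈ₖ? (κ ∷ κs)) all
      bound = begin
        length all                                ≡⟨ #-complement near? all ⟩
        # near? all + length rest                 ≤⟨ +-mono-≤ (weight-∈ all w (proj₂ (proj₂ top)) (κ ∷ nb κ)) (proj₁ (proj₂ rec)) ⟩
        suc (length (nb κ)) * w + suc Δ * in-κs rest
                                                  ≤⟨ +-mono-≤ (*-monoˡ-≤ w (s≤s (small y∈)))
                                                              (*-monoʳ-≤ (suc Δ) (#-filter (λ z → key z ∈ₖ? κs) (¬? ∘ near?) all)) ⟩
        suc Δ * w + suc Δ * in-κs all             ≡⟨ *-distribˡ-+ (suc Δ) w (in-κs all) ⟨
        suc Δ * (w + in-κs all)                   ≤⟨ *-monoʳ-≤ (suc Δ)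
                                                       (#-disjoint (λ z → key z ≟ₖ κ) (λ z → key z ∈ₖ? κs) (λ z → key z ∈ₖ? (κ ∷ κs)) all
                                                         (λ eq ∈κs → far (subst (_∈ κs) eq ∈κs) (here refl)) here there) ⟩
        suc Δ * # (λ z → key z ∈ₖ? (κ ∷ κs)) all  ∎
        where open ≤-Reasoning

-- The lower bound

∣⁅u⁆∪p∣≡suc∣p∣ : (u : Fin n) (p : Subset n) → u ∉ₛ p → ∣ ⁅ u ⁆ ∪ p ∣ ≡ suc ∣ p ∣
∣⁅u⁆∪p∣≡suc∣p∣ zero    (inside ∷ p)  u∉ = contradiction here u∉
∣⁅u⁆∪p∣≡suc∣p∣ zero    (outside ∷ p) u∉ = cong (suc ∘ ∣_∣) (∪-identityˡ p)
∣⁅u⁆∪p∣≡suc∣p∣ (suc u) (inside ∷ p)  u∉ = cong suc (∣⁅u⁆∪p∣≡suc∣p∣ u p (u∉ ∘ there))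
∣⁅u⁆∪p∣≡suc∣p∣ (suc u) (outside ∷ p) u∉ = ∣⁅u⁆∪p∣≡suc∣p∣ u p (u∉ ∘ there)

#-any-concatMap : {P : Pred B ℓ} (P? : Decidable P) (f : A → List B) (xs : List A) →
  # (any? P? ∘ f) xs ≤ # P? (concatMap f xs)
#-any-concatMap P? f []       = z≤n
#-any-concatMap P? f (x ∷ xs)
  rewrite filter-++ P? (f x) (concatMap f xs) | length-++ (filter P? (f x)) {filter P? (concatMap f xs)}
  with any? P? (f x)
... | yes found = +-mono-≤ (filter-some P? found) (#-any-concatMap P? f xs)
... | no  _     = ≤-trans (#-any-concatMap P? f xs) (m≤n+m _ (# P? (f x)))

pairwise⇒AllPairs : {R : A → A → Set} {xs : List A} → Unique xs →
  (∀ {x y} → x ∈ xs → y ∈ xs → x ≢ y → R x y) → AllPairs R xs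
pairwise⇒AllPairs []          r = []
pairwise⇒AllPairs (x≢ ∷ uniq) r =
  All.tabulate (λ y∈ → r (here refl) (there y∈) (All.lookup x≢ y∈))
  ∷ pairwise⇒AllPairs uniq (λ x∈ y∈ → r (there x∈) (there y∈))

-- Among the at most m k vertices covering the members that contain `A`, averaging yields one lying
-- in a 1/(m k) fraction of them. It is outside `A`, so adding it raises the size by exactly one.
popular-core : ∀ {k m L} (Fs : Family n) → 2 ≤ m → Uniform k Fs → ¬ HasLSunflower L m Fs → 0 < length Fs →
  ∀ i → i ≤ k → (∀ j → j < i → j ∈ L) →
  Σ (Subset n) λ A → ∣ A ∣ ≡ i × length Fs ≤ (m * k) ^ i * # (A ⊆ₛ?_) Fs
popular-core {n} Fs 2≤m unif none 0<F zero    i≤k all∈L =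
  ⊥ , ∣⊥∣≡0 n , ≤-reflexive (trans (cong length (sym (filter-all (⊥ ⊆ₛ?_) (All.universal {P = ⊥ ⊆_} (λ _ {_} x∈ → ⊥⊆ x∈) Fs)))) (sym (*-identityˡ _)))
popular-core {n} {k} {m} {L} Fs 2≤m unif none 0<F (suc i) i<k all∈L
  with A , ∣A∣ , le ← popular-core Fs 2≤m unif none 0<F i (<⇒≤ i<k) (λ j j<i → all∈L j (m≤n⇒m≤1+n j<i))
  with U , U≤ , U∉A , hit ← noSunflower⇒cover Fs 2≤m unif none A (subst (_∈ L) (sym ∣A∣) (all∈L i ≤-refl)) (subst (_< k) (sym ∣A∣) i<k)
  with pigeonhole (λ u G → u ∈ₛ? G) U (filter (A ⊆ₛ?_) Fs) hit
... | inj₁ empty = contradiction 0<F (≤⇒≯ (≤-trans le (≤-reflexive (trans (cong (λ l → (m * k) ^ i * length l) empty) (*-zeroʳ ((m * k) ^ i))))))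
... | inj₂ (u , u∈U , le′) = ⁅ u ⁆ ∪ A , trans (∣⁅u⁆∪p∣≡suc∣p∣ u A (All.lookup U∉A u∈U)) (cong suc ∣A∣) , (begin
  length Fs                                               ≤⟨ le ⟩
  (m * k) ^ i * # (A ⊆ₛ?_) Fs                             ≤⟨ *-monoʳ-≤ ((m * k) ^ i) le′ ⟩
  (m * k) ^ i * (length U * # (u ∈ₛ?_) FA)                ≤⟨ *-monoʳ-≤ ((m * k) ^ i) (*-mono-≤ U≤ (≤-trans (#-mono (u ∈ₛ?_) (A′ ⊆ₛ?_) FA into) (#-filter (A′ ⊆ₛ?_) (A ⊆ₛ?_) Fs))) ⟩
  (m * k) ^ i * (m * k * # (A′ ⊆ₛ?_) Fs)                  ≡⟨ *-assoc ((m * k) ^ i) (m * k) _ ⟨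
  (m * k) ^ i * (m * k) * # (A′ ⊆ₛ?_) Fs                  ≡⟨ cong (_* # (A′ ⊆ₛ?_) Fs) (*-comm ((m * k) ^ i) (m * k)) ⟩
  (m * k) ^ suc i * # (A′ ⊆ₛ?_) Fs                        ∎)
  where
  open ≤-Reasoning
  FA = filter (A ⊆ₛ?_) Fs
  A′ = ⁅ u ⁆ ∪ A
  into : ∀ {G} → G ∈ FA → u ∈ₛ G → A′ ⊆ G
  into G∈ u∈G x∈ = [ (λ x∈u → subst (_∈ₛ _) (sym (x∈⁅y⁆⇒x≡y u x∈u)) u∈G) , proj₂ (∈-filter⁻ (A ⊆ₛ?_) {xs = Fs} G∈) ]′ (x∈p∪q⁻ ⁅ u ⁆ A x∈)

-- For one member G: k * k ordered pairs inside G, and, for each of its 2 ^ k subsets T, its k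
-- vertices against at most m * k vertices of the cover of T.
pairBound : ℕ → ℕ → ℕ
pairBound k m = k * k + 2 ^ k * (k * (m * k))

colours : ℕ → ℕ → ℕ
colours k m = suc (2 * pairBound k m)

degree : ℕ → ℕ → ℕ → ℕ
degree k m b = 2 ^ k * suc (colours k m) ^ (k ∸ b)

-- Colouring and thinning the members that contain the core

module Sparsify {n k m : ℕ} {L : List ℕ} (1≤k : 1 ≤ k) (2≤m : 2 ≤ m) (L<k : All (_< k) L) {a b : ℕ}
  (isB : IsB k L a b) (F : Family n) (uniqF : Unique F) (unif : Uniform k F) (none : ¬ HasLSunflower L m F)
  (A : Subset n) (∣A∣≡a : ∣ A ∣ ≡ a) where

  Fs : Family n
  Fs = filter (A ⊆ₛ?_) F

  ∈Fs⇒ : ∀ {G} → G ∈ Fs → G ∈ F × A ⊆ G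
  ∈Fs⇒ = ∈-filter⁻ (A ⊆ₛ?_) {xs = F}

  P = pairBound k m
  Q = colours k m

  cover-of : (T : Subset n) → ∣ T ∣ ∈ L → Σ (List (Fin n)) λ U → length U ≤ m * k × Covers T U (filter (T ⊆ₛ?_) F)
  cover-of T T∈L = noSunflower⇒cover F 2≤m unif none T T∈L (All.lookup L<k T∈L)

  -- The empty list for sizes outside L makes this total in T, so the pairs of a member can be
  -- listed over all of its subsets.
  cover : Subset n → List (Fin n)
  cover T with ∣ T ∣ ∈? L
  ... | yes T∈L = proj₁ (cover-of T T∈L)
  ... | no  _   = []

  length-cover : ∀ T → length (cover T) ≤ m * k
  length-cover T with ∣ T ∣ ∈? L
  ... | yes T∈L = proj₁ (proj₂ (cover-of T T∈L))
  ... | no  _   = z≤n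

  cover-hits : ∀ {T G} → ∣ T ∣ ∈ L → G ∈ F → T ⊆ G → ∃ λ w → w ∈ cover T × w ∈ₛ G × w ∉ₛ T
  cover-hits {T} T∈L G∈ T⊆G with ∣ T ∣ ∈? L
  ... | no  T∉L = contradiction T∈L T∉L
  ... | yes T∈L′ with cover-of T T∈L′
  ...   | U , _ , U∉T , hit with hit (∈-filter⁺ (T ⊆ₛ?_) G∈ T⊆G)
  ...     | w , w∈U , w∈G = w , w∈U , w∈G , All.lookup U∉T w∈U

  distinct? : Decidable (λ ((u , v) : Fin n × Fin n) → u ≢ v)
  distinct? (u , v) = ¬? (u Fin.≟ v)

  inner outer pairs : Subset n → List (Fin n × Fin n)
  inner G = filter distinct? (cartesianProduct (elements G) (elements G))
  outer G = concatMap (λ T → cartesianProduct (elements G) (filter (λ w → ¬? (w ∈ₛ? G)) (cover T))) (powerset G)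
  pairs G = inner G ++ outer G

  length-pairs : ∀ {G} → ∣ G ∣ ≡ k → length (pairs G) ≤ P
  length-pairs {G} ∣G∣≡k = begin
    length (pairs G)                      ≡⟨ length-++ (inner G) ⟩
    length (inner G) + length (outer G)   ≤⟨ +-mono-≤ (length-filter distinct? (cartesianProduct (elements G) (elements G)))
                                                      (length-concatMap _ (powerset G) (k * (m * k)) (λ {T} _ → each T)) ⟩
    length (cartesianProduct (elements G) (elements G)) + length (powerset G) * (k * (m * k))
                                          ≡⟨ cong₂ (λ x y → x + y * (k * (m * k)))
                                               (trans (length-cartesianProductWith _,_ (elements G) (elements G)) (cong₂ _*_ ∣els∣ ∣els∣))
                                               (trans (length-powerset G) (cong (2 ^_) ∣G∣≡k)) ⟩
    P                                     ∎
    where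
    open ≤-Reasoning
    ∣els∣ : length (elements G) ≡ k
    ∣els∣ = trans (length-elements G) ∣G∣≡k
    each : ∀ T → length (cartesianProduct (elements G) (filter (λ w → ¬? (w ∈ₛ? G)) (cover T))) ≤ k * (m * k)
    each T = begin
      length (cartesianProduct (elements G) (filter (λ w → ¬? (w ∈ₛ? G)) (cover T)))
        ≡⟨ length-cartesianProductWith _,_ (elements G) _ ⟩
      length (elements G) * length (filter (λ w → ¬? (w ∈ₛ? G)) (cover T))
        ≤⟨ *-mono-≤ (≤-reflexive ∣els∣) (≤-trans (length-filter _ (cover T)) (length-cover T)) ⟩
      k * (m * k) ∎

  ∈-outer⁻ : ∀ {G v w} → (v , w) ∈ outer G → v ∈ₛ G × w ∉ₛ G
  ∈-outer⁻ {G} vw∈ with find (∈-concatMap⁻ _ {xs = powerset G} vw∈)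
  ... | T , _ , vw∈T with ∈-cartesianProduct⁻ (elements G) _ vw∈T
  ...   | v∈ , w∈ = ∈-elements⁻ v∈ , proj₂ (∈-filter⁻ (λ w → ¬? (w ∈ₛ? G)) {xs = cover T} w∈)

  ∈-outer⁺ : ∀ {G T v w} → T ⊆ G → v ∈ₛ G → w ∈ cover T → w ∉ₛ G → (v , w) ∈ outer G
  ∈-outer⁺ {G} T⊆G v∈ w∈ w∉ = ∈-concatMap⁺ _ (lose (∈-powerset T⊆G)
    (∈-cartesianProduct⁺ (∈-elements⁺ v∈) (∈-filter⁺ (λ w → ¬? (w ∈ₛ? G)) w∈ w∉)))

  pairs-distinct : ∀ G → All (λ (u , v) → u ≢ v) (pairs G)
  pairs-distinct G = All.++⁺ (All.all-filter distinct? (cartesianProduct (elements G) (elements G)))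
    (All.tabulate (λ vw∈ eq → let v∈ , w∉ = ∈-outer⁻ {G} vw∈ in w∉ (subst (_∈ₛ G) eq v∈)))

  abstract
    colouring : Σ (Fin n → Fin Q) λ χ → Q * # (mono? χ) (concatMap pairs Fs) ≤ length (concatMap pairs Fs)
    colouring = ∃-colouring {q = 2 * P} (concatMap pairs Fs) (All.concat⁺ (All.map⁺ (All.universal pairs-distinct Fs)))

  χ : Fin n → Fin Q
  χ = proj₁ colouring

  Good : Subset n → Set
  Good G = ¬ Any (Monochromatic χ) (pairs G)

  bad? : Decidable (Any (Monochromatic χ) ∘ pairs)
  bad? = any? (mono? χ) ∘ pairs

  Gs : Family n
  Gs = filter (¬? ∘ bad?) Fs

  ∈Gs⇒ : ∀ {G} → G ∈ Gs → G ∈ Fs × Good G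
  ∈Gs⇒ = ∈-filter⁻ (¬? ∘ bad?) {xs = Fs}

  -- Each bad member owns a monochromatic pair, so Q times the number of bad members is at most the
  -- total number of pairs, hence at most P times the number of members; and Q exceeds 2P.
  half-good : length Fs ≤ 2 * length Gs
  half-good = begin
    length Fs                 ≡⟨ #-complement bad? Fs ⟩
    # bad? Fs + length Gs     ≤⟨ +-monoˡ-≤ (length Gs) bad≤good ⟩
    length Gs + length Gs     ≡⟨ cong (length Gs +_) (sym (+-identityʳ _)) ⟩
    2 * length Gs             ∎
    where
    open ≤-Reasoning
    instance
      P≢0 : ℕ.NonZero P
      P≢0 = ℕ.>-nonZero (≤-trans (*-mono-≤ 1≤k 1≤k) (m≤m+n (k * k) _))
    twice : P * (2 * # bad? Fs) ≤ P * length Fs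
    twice = begin
      P * (2 * # bad? Fs)                                 ≡⟨ *-assoc P 2 _ ⟨
      P * 2 * # bad? Fs                                   ≡⟨ cong (_* # bad? Fs) (*-comm P 2) ⟩
      2 * P * # bad? Fs                                   ≤⟨ *-monoˡ-≤ (# bad? Fs) (n≤1+n (2 * P)) ⟩
      Q * # bad? Fs                                       ≤⟨ *-monoʳ-≤ Q (#-any-concatMap (mono? χ) pairs Fs) ⟩
      Q * # (mono? χ) (concatMap pairs Fs)                ≤⟨ proj₂ colouring ⟩
      length (concatMap pairs Fs)                         ≤⟨ length-concatMap pairs Fs P (λ {G} G∈ → length-pairs {G} (All.lookup unif (proj₁ (∈Fs⇒ G∈)))) ⟩
      length Fs * P                                       ≡⟨ *-comm (length Fs) P ⟩
      P * length Fs                                       ∎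
    bad≤good : # bad? Fs ≤ length Gs
    bad≤good = +-cancelˡ-≤ (# bad? Fs) _ _ (begin
      # bad? Fs + # bad? Fs    ≡⟨ cong (# bad? Fs +_) (+-identityʳ _) ⟨
      2 * # bad? Fs            ≤⟨ *-cancelˡ-≤ P twice ⟩
      length Fs                ≡⟨ #-complement bad? Fs ⟩
      # bad? Fs + length Gs    ∎)

  key : Subset n → Subset Q
  key = image χ

  -- Built to contain every colour set of size at most k that meets κ in b or more colours: such a
  -- set is a part of κ together with at most k - b further colours.
  nb : Subset Q → List (Subset Q)
  nb κ = cartesianProductWith _∪_ (powerset κ) (boundedSubsets Q (k ∸ b))

  ∣key∣≤k : ∀ {G} → G ∈ F → ∣ key G ∣ ≤ k
  ∣key∣≤k {G} G∈ = ≤-trans (∣image∣≤ χ G) (≤-reflexive (All.lookup unif G∈))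

  length-nb : ∀ {G} → G ∈ Gs → length (nb (key G)) ≤ degree k m b
  length-nb {G} G∈ = begin
    length (nb (key G))                                       ≡⟨ length-cartesianProductWith _∪_ (powerset (key G)) _ ⟩
    length (powerset (key G)) * length (boundedSubsets Q (k ∸ b))      ≡⟨ cong₂ _*_ (length-powerset (key G)) (length-boundedSubsets Q (k ∸ b)) ⟩
    2 ^ ∣ key G ∣ * suc Q ^ (k ∸ b)                           ≤⟨ *-monoˡ-≤ (suc Q ^ (k ∸ b)) (^-monoʳ-≤ 2 (∣key∣≤k (proj₁ (∈Fs⇒ (proj₁ (∈Gs⇒ G∈)))))) ⟩
    2 ^ k * suc Q ^ (k ∸ b)                                   ∎
    where open ≤-Reasoning

  near : ∀ {κ κ′ : Subset Q} → ∣ κ′ ∣ ≤ k → b ≤ ∣ κ′ ∩ κ ∣ → κ′ ∈ nb κ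
  near {κ} {κ′} κ′≤k b≤ = subst (_∈ nb κ) (p∩q∪p─q≡p κ′ κ)
    (∈-cartesianProductWith⁺ _∪_ (∈-powerset (p∩q⊆q κ′ κ)) (∈-boundedSubsets (begin
      ∣ κ′ ─ κ ∣                                     ≡⟨ m+n∸m≡n ∣ κ′ ∩ κ ∣ _ ⟨
      ∣ κ′ ∩ κ ∣ + ∣ κ′ ─ κ ∣ ∸ ∣ κ′ ∩ κ ∣           ≡⟨ cong (_∸ ∣ κ′ ∩ κ ∣) (∣p∣≡∣p∩q∣+∣p─q∣ κ′ κ) ⟨
      ∣ κ′ ∣ ∸ ∣ κ′ ∩ κ ∣                            ≤⟨ ∸-mono κ′≤k b≤ ⟩
      k ∸ b                                          ∎)))
    where open ≤-Reasoning

  module Sel = Select _≟ₛ_ key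
  open import Data.List.Membership.DecPropositional (_≟ₛ_ {Q}) using () renaming (_∈?_ to _∈ₖ?_)

  abstract
    selection : Σ (List (Subset Q)) λ κs → (length Gs ≤ suc (degree k m b) * # (λ G → key G ∈ₖ? κs) Gs)
      × (∀ {κ κ′} → κ ∈ κs → κ′ ∈ κs → κ ≡ κ′ ⊎ κ′ ∉ nb κ ⊎ κ ∉ nb κ′)
    selection = Sel.select nb (degree k m b) Gs length-nb
  κs = proj₁ selection

  F′ : Family n
  F′ = filter (λ G → key G ∈ₖ? κs) Gs

  many : length Gs ≤ suc (degree k m b) * length F′
  many = proj₁ (proj₂ selection)

  ∈F′⇒ : ∀ {G} → G ∈ F′ → G ∈ Gs × key G ∈ κs
  ∈F′⇒ = ∈-filter⁻ (λ G → key G ∈ₖ? κs) {xs = Gs}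

  ∈F′⇒F : ∀ {G} → G ∈ F′ → G ∈ F × A ⊆ G × Good G
  ∈F′⇒F G∈ = let G∈Fs , good = ∈Gs⇒ (proj₁ (∈F′⇒ G∈)) ; G∈F , A⊆G = ∈Fs⇒ G∈Fs in G∈F , A⊆G , good

  b≤-meet : ∀ {G H} → G ∈ F′ → H ∈ F′ → ∣ G ∩ H ∣ ∈ L → b ≤ ∣ G ∩ H ∣
  b≤-meet {G} {H} G∈ H∈ ∈L with b ≤? ∣ G ∩ H ∣
  ... | yes b≤ = b≤
  ... | no  b≰ = contradiction ∈L (proj₁ (proj₂ (proj₂ isB) ∣ G ∩ H ∣ a≤ (≰⇒> b≰)))
    where
    a≤ : a ≤ ∣ G ∩ H ∣
    a≤ = subst (_≤ ∣ G ∩ H ∣) ∣A∣≡a (p⊆q⇒∣p∣≤∣q∣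
      (λ x∈ → x∈p∩q⁺ (proj₁ (proj₂ (∈F′⇒F G∈)) x∈ , proj₁ (proj₂ (∈F′⇒F H∈)) x∈)))

  χ-injective : ∀ {G x y} → Good G → x ∈ₛ G → y ∈ₛ G → χ x ≡ χ y → x ≡ y
  χ-injective {G} {x} {y} good x∈ y∈ eq with x Fin.≟ y
  ... | yes x≡y = x≡y
  ... | no  x≢y = contradiction (lose {P = Monochromatic χ} (∈-++⁺ˡ {xs = inner G}
    (∈-filter⁺ distinct? (∈-cartesianProduct⁺ (∈-elements⁺ x∈) (∈-elements⁺ y∈)) x≢y)) eq) good

  -- A good member has no two vertices of one colour, so the vertices of G ∩ H yield as many common
  -- colours.
  meet≤key-meet : ∀ {G H} → G ∈ F′ → ∣ G ∩ H ∣ ≤ ∣ key G ∩ key H ∣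
  meet≤key-meet {G} {H} G∈ = injective⇒∣∣≤ χ (G ∩ H) (key G ∩ key H)
    (λ x∈ → let x∈G , x∈H = x∈p∩q⁻ G H x∈ in x∈p∩q⁺ (∈-image⁺ χ {G} x∈G , ∈-image⁺ χ {H} x∈H))
    (λ x∈ y∈ → χ-injective (proj₂ (proj₂ (∈F′⇒F G∈))) (p∩q⊆p G H x∈) (p∩q⊆p G H y∈))

  -- Different selected keys fail to be neighbours in at least one direction, whereas sharing b or
  -- more colours makes them neighbours in both.
  same-key : ∀ {G H} → G ∈ F′ → H ∈ F′ → ∣ G ∩ H ∣ ∈ L → key G ≡ key H
  same-key {G} {H} G∈ H∈ ∈L with proj₂ (proj₂ selection) (proj₂ (∈F′⇒ G∈)) (proj₂ (∈F′⇒ H∈))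
  ... | inj₁ eq         = eq
  ... | inj₂ (inj₁ H∉) = contradiction (near (∣key∣≤k (proj₁ (∈F′⇒F H∈)))
    (subst (λ p → b ≤ ∣ p ∣) (∩-comm (key G) (key H)) (≤-trans (b≤-meet G∈ H∈ ∈L) (meet≤key-meet {G} {H} G∈)))) H∉
  ... | inj₂ (inj₂ G∉) = contradiction (near (∣key∣≤k (proj₁ (∈F′⇒F G∈)))
    (≤-trans (b≤-meet G∈ H∈ ∈L) (meet≤key-meet {G} {H} G∈))) G∉

  -- A member of the cover of G ∩ H inside H shares its colour with some vertex of G, contrary to G being good.
  avoids : ∀ {G H} → G ∈ F′ → H ∈ F′ → ¬ (∣ G ∩ H ∣ ∈ L)
  avoids {G} {H} G∈ H∈ ∈L
    with w , w∈U , w∈H , w∉T ← cover-hits ∈L (proj₁ (∈F′⇒F H∈)) (p∩q⊆q G H)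
    with v , v∈G , eq ← ∈-image⁻ χ {G} (subst (χ w ∈ₛ_) (sym (same-key G∈ H∈ ∈L)) (∈-image⁺ χ {H} w∈H))
    = proj₂ (proj₂ (∈F′⇒F G∈)) (lose (∈-++⁺ʳ (inner G)
        (∈-outer⁺ {G} (p∩q⊆p G H) v∈G w∈U (λ w∈G → w∉T (x∈p∩q⁺ (w∈G , w∈H))))) (sym eq))

  subfamily : SubFamily F′ F
  subfamily = Unique.filter⁺ _ (Unique.filter⁺ _ (Unique.filter⁺ _ uniqF)) , All.tabulate (proj₁ ∘ ∈F′⇒F)

  avoidsL : AvoidsL L F′
  avoidsL = pairwise⇒AllPairs (proj₁ subfamily) (λ G∈ H∈ _ → avoids G∈ H∈)

-- The factor `k ^ k` pays for the core, 2 for the bad members, and the last factor for the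
-- selection of colour sets; the base raised to the power k is `suc (colours k 1)`.
lower-constant : ℕ → ℕ
lower-constant k = k ^ k * (2 * suc (2 ^ k * (2 + 2 * (k * k + 2 ^ k * (k * k))) ^ k))

^-distribʳ-* : ∀ m n e → (m * n) ^ e ≡ m ^ e * n ^ e
^-distribʳ-* m n zero    = refl
^-distribʳ-* m n (suc e) = begin
  m * n * (m * n) ^ e         ≡⟨ cong (m * n *_) (^-distribʳ-* m n e) ⟩
  m * n * (m ^ e * n ^ e)     ≡⟨ [m*n]*[o*p]≡[m*o]*[n*p] m n (m ^ e) (n ^ e) ⟩
  m * m ^ e * (n * n ^ e)     ∎
  where open ≡-Reasoning

isB⇒b≤k : ∀ {k L a b} → All (_< k) L → IsB k L a b → b ≤ k
isB⇒b≤k L<k (_ , inj₁ b∈L , _) = <⇒≤ (All.lookup L<k b∈L)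
isB⇒b≤k L<k (_ , inj₂ refl , _) = ≤-refl

-- The number of colours grows at most linearly in m, so m times its value at m = 1 bounds it; the
-- power k - b of that m is then pulled out, and the leading 1 is absorbed into it.
degree-bound : ∀ k m b → 1 ≤ m → suc (degree k m b) ≤ m ^ (k ∸ b) * suc (2 ^ k * (2 + 2 * (k * k + 2 ^ k * (k * k))) ^ k)
degree-bound k m@(suc _) b _ = begin
  suc (2 ^ k * suc (colours k m) ^ e)       ≤⟨ s≤s (*-monoʳ-≤ (2 ^ k) (^-monoˡ-≤ e colours≤)) ⟩
  suc (2 ^ k * (m * D) ^ e)                 ≡⟨ cong (λ x → suc (2 ^ k * x)) (^-distribʳ-* m D e) ⟩
  suc (2 ^ k * (m ^ e * D ^ e))             ≡⟨ cong suc (x∙yz≈y∙xz (2 ^ k) (m ^ e) (D ^ e)) ⟩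
  1 + m ^ e * (2 ^ k * D ^ e)               ≤⟨ +-mono-≤ (m^n>0 m e) (*-monoʳ-≤ (m ^ e) (*-monoʳ-≤ (2 ^ k) (^-monoʳ-≤ D (m∸n≤m k b)))) ⟩
  m ^ e + m ^ e * (2 ^ k * D ^ k)           ≡⟨ *-suc (m ^ e) _ ⟨
  m ^ e * suc (2 ^ k * D ^ k)               ∎
  where
  open ≤-Reasoning
  open import Algebra.Properties.CommutativeSemigroup *-commutativeSemigroup using (x∙yz≈y∙xz)
  e = k ∸ b
  P₁ = k * k + 2 ^ k * (k * k)
  D = 2 + 2 * P₁
  pairs≤ : pairBound k m ≤ m * P₁
  pairs≤ = begin
    k * k + 2 ^ k * (k * (m * k))           ≡⟨ cong (λ x → k * k + 2 ^ k * x) (x∙yz≈y∙xz k m k) ⟩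
    k * k + 2 ^ k * (m * (k * k))           ≡⟨ cong (k * k +_) (x∙yz≈y∙xz (2 ^ k) m (k * k)) ⟩
    k * k + m * (2 ^ k * (k * k))           ≤⟨ +-monoˡ-≤ _ (m≤n*m (k * k) m) ⟩
    m * (k * k) + m * (2 ^ k * (k * k))     ≡⟨ *-distribˡ-+ m (k * k) _ ⟨
    m * P₁                                  ∎
  colours≤ : suc (colours k m) ≤ m * D
  colours≤ = begin
    2 + 2 * pairBound k m     ≤⟨ +-mono-≤ (m≤n*m 2 m) (*-monoʳ-≤ 2 pairs≤) ⟩
    m * 2 + 2 * (m * P₁)      ≡⟨ cong (m * 2 +_) (x∙yz≈y∙xz 2 m P₁) ⟩
    m * 2 + m * (2 * P₁)      ≡⟨ *-distribˡ-+ m 2 (2 * P₁) ⟨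
    m * D                     ∎

lower-bound : ∀ k → 1 ≤ k → ∀ m → 2 ≤ m → ∀ (L : SizeSet k) a b → IsA (proj₁ L) a → IsB k (proj₁ L) a b →
  ∀ n (F : Family n) → Unique F → Uniform k F → ¬ HasLSunflower (proj₁ L) m F →
  Σ (Family n) λ F′ → SubFamily F′ F × AvoidsL (proj₁ L) F′
    × length F ≤ lower-constant k * (m ^ ((k ∸ b) + a) * length F′)
lower-bound k 1≤k m 2≤m (L , L<k) a b isA isB n []          uniq unif none = [] , ([] , []) , [] , z≤n
lower-bound k@(suc _) 1≤k m 2≤m (L , L<k) a b isA isB n F@(_ ∷ _) uniq unif none
  with A , ∣A∣ , popular ← popular-core F 2≤m unif none (s≤s z≤n) a (≤-trans (proj₁ isB) (isB⇒b≤k L<k isB)) (proj₂ isA)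
  = F′ , subfamily , avoidsL , (begin
  length F                                                        ≤⟨ popular ⟩
  (m * k) ^ a * length Fs                                         ≤⟨ *-monoʳ-≤ ((m * k) ^ a) half-good ⟩
  (m * k) ^ a * (2 * length Gs)                                   ≤⟨ *-mono-≤ core≤ (*-monoʳ-≤ 2 (≤-trans many (*-monoˡ-≤ (length F′) (degree-bound k m b (<⇒≤ 2≤m))))) ⟩
  m ^ a * k ^ k * (2 * (m ^ (k ∸ b) * E * length F′))             ≡⟨ rearrange (m ^ a) (k ^ k) (m ^ (k ∸ b)) E (length F′) ⟩
  k ^ k * (2 * E) * (m ^ (k ∸ b) * m ^ a * length F′)             ≡⟨ cong (λ x → k ^ k * (2 * E) * (x * length F′)) (^-distribˡ-+-* m (k ∸ b) a) ⟨
  k ^ k * (2 * E) * (m ^ ((k ∸ b) + a) * length F′)               ∎)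
  where
  open ≤-Reasoning
  open Sparsify 1≤k 2≤m L<k isB F uniq unif none A ∣A∣
  E = suc (2 ^ k * (2 + 2 * (k * k + 2 ^ k * (k * k))) ^ k)
  core≤ : (m * k) ^ a ≤ m ^ a * k ^ k
  core≤ = begin
    (m * k) ^ a      ≡⟨ ^-distribʳ-* m k a ⟩
    m ^ a * k ^ a    ≤⟨ *-monoʳ-≤ (m ^ a) (^-monoʳ-≤ k (≤-trans (proj₁ isB) (isB⇒b≤k L<k isB))) ⟩
    m ^ a * k ^ k    ∎
  rearrange : ∀ x y z w f → x * y * (2 * (z * w * f)) ≡ y * (2 * w) * (z * x * f)
  rearrange = solve-∀

-- Encoding points by sets whose intersection sizes count agreements

occurrences : {P : ℕ → Set ℓ} → Decidable P → ℕ → ℕ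
occurrences P? zero    = 0
occurrences P? (suc k) with P? k
... | yes _ = suc (occurrences P? k)
... | no  _ = occurrences P? k

module _ {P : ℕ → Set ℓ} (P? : Decidable P) where

  occurrences-run : ∀ lo d → (∀ {e} → lo ≤ e → e < d + lo → P e) → occurrences P? (d + lo) ≡ d + occurrences P? lo
  occurrences-run lo zero    p = refl
  occurrences-run lo (suc d) p with P? (d + lo)
  ... | yes _  = cong suc (occurrences-run lo d (λ lo≤ e< → p lo≤ (m≤n⇒m≤1+n e<)))
  ... | no  ¬p = contradiction (p (m≤n+m lo d) ≤-refl) ¬p

  occurrences-gap : ∀ lo d → (∀ {e} → lo ≤ e → e < d + lo → ¬ P e) → occurrences P? (d + lo) ≡ occurrences P? lo
  occurrences-gap lo zero    ¬p = refl
  occurrences-gap lo (suc d) ¬p with P? (d + lo)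
  ... | yes p = contradiction p (¬p (m≤n+m lo d) ≤-refl)
  ... | no  _ = occurrences-gap lo d (λ lo≤ e< → ¬p lo≤ (m≤n⇒m≤1+n e<))

  occurrences-initial : ∀ {c k} → c ≤ k → (∀ {e} → e < c → P e) → (∀ {e} → c ≤ e → e < k → ¬ P e) →
    occurrences P? k ≡ c
  occurrences-initial {c} {k} c≤k below above = begin
    occurrences P? k              ≡⟨ cong (occurrences P?) (m∸n+n≡m c≤k) ⟨
    occurrences P? (k ∸ c + c)    ≡⟨ occurrences-gap c (k ∸ c) (λ {e} c≤ e< → above c≤ (subst (e <_) (m∸n+n≡m c≤k) e<)) ⟩
    occurrences P? c              ≡⟨ cong (occurrences P?) (+-identityʳ c) ⟨
    occurrences P? (c + 0)        ≡⟨ occurrences-run 0 c (λ {e} _ e< → below (subst (e <_) (+-identityʳ c) e<)) ⟩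
    c + 0                         ≡⟨ +-identityʳ c ⟩
    c                             ∎
    where open ≡-Reasoning

  occurrences-initial+1 : ∀ {b c k} → b ≤ c → c < k → (∀ {e} → e < b → P e) → P c →
    (∀ {e} → b ≤ e → e < k → e ≢ c → ¬ P e) → occurrences P? k ≡ suc b
  occurrences-initial+1 {b} {c} {k} b≤c c<k below Pc others = begin
    occurrences P? k                      ≡⟨ cong (occurrences P?) (m∸n+n≡m c<k) ⟨
    occurrences P? (k ∸ suc c + suc c)    ≡⟨ occurrences-gap (suc c) (k ∸ suc c)
                                               (λ {e} c< e< → others (≤-trans b≤c (<⇒≤ c<)) (subst (e <_) (m∸n+n≡m c<k) e<) (λ { refl → n≮n _ c< })) ⟩
    occurrences P? (suc c)                ≡⟨ occurrences-run c 1 (λ c≤ e< → subst P (≤-antisym c≤ (s≤s⁻¹ e<)) Pc) ⟩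
    suc (occurrences P? c)                ≡⟨ cong suc (occurrences-initial b≤c below (λ b≤ e< → others b≤ (<-trans e< c<k) (<⇒≢ e<))) ⟩
    suc b                                 ∎
    where open ≡-Reasoning

∣p++q∣ : ∀ {m n} (p : Subset m) (q : Subset n) → ∣ p ++ᵥ q ∣ ≡ ∣ p ∣ + ∣ q ∣
∣p++q∣ []            q = refl
∣p++q∣ (inside ∷ p)  q = cong suc (∣p++q∣ p q)
∣p++q∣ (outside ∷ p) q = ∣p++q∣ p q

⁅⁆∩⁅⁆-≢ : {i j : Fin n} → i ≢ j → ⁅ i ⁆ ∩ ⁅ j ⁆ ≡ ⊥
⁅⁆∩⁅⁆-≢ {i = i} {j} i≢j = Empty-unique (λ (x , x∈) → let x∈i , x∈j = x∈p∩q⁻ ⁅ i ⁆ ⁅ j ⁆ x∈ in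
  i≢j (trans (sym (x∈⁅y⁆⇒x≡y i x∈i)) (x∈⁅y⁆⇒x≡y j x∈j)))

firstIndex : {P : Pred A ℓ} → Decidable P → (xs : List A) → Fin (suc (length xs))
firstIndex P? []       = zero
firstIndex P? (x ∷ xs) with P? x
... | yes _ = zero
... | no  _ = suc (firstIndex P? xs)

firstIndex-cong : {P : Pred A ℓ} {Q : Pred A ℓ′} (P? : Decidable P) (Q? : Decidable Q) (xs : List A) →
  (∀ {x} → P x → Q x) → (∀ {x} → Q x → P x) → firstIndex P? xs ≡ firstIndex Q? xs
firstIndex-cong P? Q? []       pq qp = refl
firstIndex-cong P? Q? (x ∷ xs) pq qp with P? x | Q? x
... | yes _ | yes _ = refl
... | no  _ | no  _ = cong suc (firstIndex-cong P? Q? xs pq qp)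
... | yes p | no ¬q = contradiction (pq p) ¬q
... | no ¬p | yes q = contradiction (qp q) ¬p

firstIndex-≡ : {P : Pred A ℓ} {Q : Pred A ℓ′} (P? : Decidable P) (Q? : Decidable Q) (xs : List A) →
  Any P xs → firstIndex P? xs ≡ firstIndex Q? xs → ∃ λ x → P x × Q x
firstIndex-≡ P? Q? (x ∷ xs) any eq with P? x | Q? x
... | yes p | yes q = x , p , q
... | no ¬p | no  _ with any
...   | here p     = contradiction p ¬p
...   | there any′ = firstIndex-≡ P? Q? xs any′ (Fin.suc-injective eq)
firstIndex-≡ P? Q? (x ∷ xs) any () | yes _ | no  _
firstIndex-≡ P? Q? (x ∷ xs) any () | no  _ | yes _

module Encoding {A : Set} (points : List A) (_~[_]_ : A → ℕ → A → Set) (~? : ∀ p e q → Dec (p ~[ e ] q))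
  (~-refl : ∀ {p e} → p ~[ e ] p) (~-sym : ∀ {p e q} → p ~[ e ] q → q ~[ e ] p)
  (~-trans : ∀ {p e q r} → p ~[ e ] q → q ~[ e ] r → p ~[ e ] r) where

  width : ℕ
  width = suc (length points)

  -- A class of points agreeing at e is named by the position of its first listed point, so equal
  -- labels of listed points mean agreement.
  label : ℕ → A → Fin width
  label e p = firstIndex (~? p e) points

  label-≡ : ∀ {e p q} → p ~[ e ] q → label e p ≡ label e q
  label-≡ {e} {p} {q} p~q = firstIndex-cong (~? p e) (~? q e) points (~-trans (~-sym p~q)) (~-trans p~q)

  label-≡⁻ : ∀ {e p q} → p ∈ points → label e p ≡ label e q → p ~[ e ] q
  label-≡⁻ {e} {p} {q} p∈ eq = let r , p~r , q~r = firstIndex-≡ (~? p e) (~? q e) points (lose p∈ ~-refl) eq in ~-trans p~r (~-sym q~r)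

  -- One block of `width` vertices per index e < k, with a single vertex taken from each block:
  -- every set has size k, and intersections count the blocks of agreement.
  encode : (k : ℕ) → A → Subset (k * width)
  encode zero    p = []
  encode (suc k) p = ⁅ label k p ⁆ ++ᵥ encode k p

  agreements : ℕ → A → A → ℕ
  agreements k p q = occurrences (λ e → ~? p e q) k

  ∣encode∣ : ∀ k p → ∣ encode k p ∣ ≡ k
  ∣encode∣ zero    p = refl
  ∣encode∣ (suc k) p = trans (∣p++q∣ ⁅ label k p ⁆ (encode k p)) (cong₂ _+_ (∣⁅x⁆∣≡1 (label k p)) (∣encode∣ k p))

  ∣encode∩encode∣ : ∀ k {p q} → p ∈ points → ∣ encode k p ∩ encode k q ∣ ≡ agreements k p q
  ∣encode∩encode∣ zero    p∈ = refl
  ∣encode∩encode∣ (suc k) {p} {q} p∈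
    rewrite zipWith-++ _∧_ ⁅ label k p ⁆ (encode k p) ⁅ label k q ⁆ (encode k q)
          | ∣p++q∣ (⁅ label k p ⁆ ∩ ⁅ label k q ⁆) (encode k p ∩ encode k q)
          | ∣encode∩encode∣ k {p} {q} p∈
    with ~? p k q
  ... | yes p~q rewrite label-≡ p~q | ∩-idem ⁅ label k q ⁆ | ∣⁅x⁆∣≡1 (label k q) = refl
  ... | no  p≁q rewrite ⁅⁆∩⁅⁆-≢ (p≁q ∘ label-≡⁻ p∈) | ∣⊥∣≡0 width = refl

  encode-≡ : ∀ k {p q} → p ∈ points → encode k p ≡ encode k q → ∀ {e} → e < k → p ~[ e ] q
  encode-≡ (suc k) {p} {q} p∈ eq {e} e<k with m≤n⇒m<n∨m≡n (s≤s⁻¹ e<k)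
  ... | inj₁ e<k′ = encode-≡ k p∈ (++-injectiveʳ ⁅ label k p ⁆ ⁅ label k q ⁆ eq) e<k′
  ... | inj₂ refl = label-≡⁻ p∈ (x∈⁅y⁆⇒x≡y (label k q)
    (subst (label k p ∈ₛ_) (++-injectiveˡ ⁅ label k p ⁆ ⁅ label k q ⁆ eq) (x∈⁅x⁆ (label k p))))

  -- This is how the sunflower condition is used: a vertex that p shares with one petal is shared
  -- with every other.
  encode∩-≡ : ∀ k {p q r} → p ∈ points → encode k p ∩ encode k q ≡ encode k p ∩ encode k r →
    ∀ {e} → e < k → p ~[ e ] q → p ~[ e ] r
  encode∩-≡ (suc k) {p} {q} {r} p∈ eq {e} e<k p~q = go (m≤n⇒m<n∨m≡n (s≤s⁻¹ e<k))
    where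
    eq′ = trans (sym (zipWith-++ _∧_ ⁅ label k p ⁆ (encode k p) ⁅ label k q ⁆ (encode k q)))
                (trans eq (zipWith-++ _∧_ ⁅ label k p ⁆ (encode k p) ⁅ label k r ⁆ (encode k r)))
    go : e < k ⊎ e ≡ k → p ~[ e ] r
    go (inj₁ e<k′) = encode∩-≡ k p∈ (++-injectiveʳ (⁅ label k p ⁆ ∩ ⁅ label k q ⁆) (⁅ label k p ⁆ ∩ ⁅ label k r ⁆) eq′) e<k′ p~q
    go (inj₂ refl) = label-≡⁻ p∈ (x∈⁅y⁆⇒x≡y (label k r) (p∩q⊆q ⁅ label k p ⁆ ⁅ label k r ⁆
      (subst (label k p ∈ₛ_) (++-injectiveˡ (⁅ label k p ⁆ ∩ ⁅ label k q ⁆) (⁅ label k p ⁆ ∩ ⁅ label k r ⁆) eq′)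
        (x∈p∩q⁺ (x∈⁅x⁆ (label k p) , subst (λ i → label k p ∈ₛ ⁅ i ⁆) (label-≡ p~q) (x∈⁅x⁆ (label k p)))))))

-- Boxes of natural vectors

-- Coordinates out of range read as 0.
at : Vec ℕ n → ℕ → ℕ
at []      _       = 0
at (x ∷ v) zero    = x
at (x ∷ v) (suc i) = at v i

put : Vec ℕ n → ℕ → ℕ → Vec ℕ n
put []      _       t = []
put (x ∷ v) zero    t = t ∷ v
put (x ∷ v) (suc i) t = x ∷ put v i t

at-ext : (u v : Vec ℕ n) → (∀ {i} → i < n → at u i ≡ at v i) → u ≡ v
at-ext []      []      eq = refl
at-ext (x ∷ u) (y ∷ v) eq = cong₂ _∷_ (eq (s≤s z≤n)) (at-ext u v (eq ∘ s≤s))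

at-put : (v : Vec ℕ n) {i : ℕ} (t : ℕ) → i < n → at (put v i t) i ≡ t
at-put (x ∷ v) {zero}  t _       = refl
at-put (x ∷ v) {suc i} t (s≤s i<) = at-put v t i<

at-put-≢ : (v : Vec ℕ n) {i j : ℕ} (t : ℕ) → j ≢ i → at (put v i t) j ≡ at v j
at-put-≢ []      {_}     {_}     t j≢i = refl
at-put-≢ (x ∷ v) {zero}  {zero}  t j≢i = contradiction refl j≢i
at-put-≢ (x ∷ v) {zero}  {suc j} t j≢i = refl
at-put-≢ (x ∷ v) {suc i} {zero}  t j≢i = refl
at-put-≢ (x ∷ v) {suc i} {suc j} t j≢i = at-put-≢ v t (j≢i ∘ cong suc)

box : (ℕ → ℕ) → (n : ℕ) → List (Vec ℕ n)
box σ zero    = [] ∷ []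
box σ (suc n) = cartesianProductWith _∷_ (upTo (σ 0)) (box (σ ∘ suc) n)

∈-box⁺ : ∀ {σ} {v : Vec ℕ n} → (∀ {i} → i < n → at v i < σ i) → v ∈ box σ n
∈-box⁺ {v = []}    v< = here refl
∈-box⁺ {v = x ∷ v} v< = ∈-cartesianProductWith⁺ _∷_ (∈-upTo⁺ (v< (s≤s z≤n))) (∈-box⁺ (v< ∘ s≤s))

∈-box⁻ : ∀ {σ} {v : Vec ℕ n} → v ∈ box σ n → ∀ {i} → i < n → at v i < σ i
∈-box⁻ {σ = σ} {v = x ∷ v} v∈ {i} i<
  with ∈-cartesianProductWith⁻ _∷_ (upTo (σ 0)) (box (σ ∘ suc) _) v∈
... | _ , _ , x∈ , v∈′ , refl with i
...   | zero  = ∈-upTo⁻ x∈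
...   | suc i = ∈-box⁻ v∈′ (s≤s⁻¹ i<)

box-Unique : ∀ σ n → Unique (box σ n)
box-Unique σ zero    = [] ∷ []
box-Unique σ (suc n) = Unique.cartesianProductWith⁺ _∷_ ∷-injective (Unique.upTo⁺ (σ 0)) (box-Unique (σ ∘ suc) n)

length-box-suc : ∀ σ n → length (box σ (suc n)) ≡ σ 0 * length (box (σ ∘ suc) n)
length-box-suc σ n = trans (length-cartesianProductWith _∷_ (upTo (σ 0)) _) (cong (_* length (box (σ ∘ suc) n)) (length-upTo (σ 0)))

length-box-+ : ∀ σ m n → length (box σ (m + n)) ≡ length (box σ m) * length (box (λ i → σ (m + i)) n)
length-box-+ σ zero    n = sym (+-identityʳ _)
length-box-+ σ (suc m) n = begin
  length (box σ (suc m + n))                            ≡⟨ length-box-suc σ (m + n) ⟩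
  σ 0 * length (box (σ ∘ suc) (m + n))                  ≡⟨ cong (σ 0 *_) (length-box-+ (σ ∘ suc) m n) ⟩
  σ 0 * (length (box (σ ∘ suc) m) * length tail)        ≡⟨ *-assoc (σ 0) _ _ ⟨
  σ 0 * length (box (σ ∘ suc) m) * length tail          ≡⟨ cong (_* length tail) (length-box-suc σ m) ⟨
  length (box σ (suc m)) * length tail                  ∎
  where
  open ≡-Reasoning
  tail = box (λ i → σ (suc m + i)) n

length-box-≥ : ∀ σ n {s} → (∀ {i} → i < n → s ≤ σ i) → s ^ n ≤ length (box σ n)
length-box-≥ σ zero    s≤ = ≤-refl
length-box-≥ σ (suc n) s≤ = ≤-trans (*-mono-≤ (s≤ (s≤s z≤n)) (length-box-≥ (σ ∘ suc) n (s≤ ∘ s≤s)))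
  (≤-reflexive (sym (length-box-suc σ n)))

-- Bounded search

module _ {P : ℕ → Set ℓ} (P? : Decidable P) where

  least : ∀ k → (∀ {c} → c < k → ¬ P c) ⊎ ∃ λ c → c < k × P c × (∀ {d} → d < c → ¬ P d)
  least zero    = inj₁ λ ()
  least (suc k) with least k
  ... | inj₂ (c , c<k , p , min) = inj₂ (c , m≤n⇒m≤1+n c<k , p , min)
  ... | inj₁ none with P? k
  ...   | yes p = inj₂ (k , ≤-refl , p , none)
  ...   | no ¬p = inj₁ λ c≤k pc → [ (λ c<k → none c<k pc) , (λ { refl → ¬p pc }) ]′ (m≤n⇒m<n∨m≡n (s≤s⁻¹ c≤k))

  greatest : ∀ k → (∀ {c} → c < k → ¬ P c) ⊎ ∃ λ c → c < k × P c × (∀ {d} → c < d → d < k → ¬ P d)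
  greatest zero    = inj₁ λ ()
  greatest (suc k) with P? k
  ... | yes p = inj₂ (k , ≤-refl , p , λ k<d d≤k → contradiction (s≤s⁻¹ d≤k) (<⇒≱ k<d))
  ... | no ¬p with greatest k
  ...   | inj₁ none = inj₁ λ c≤k pc → [ (λ c<k → none c<k pc) , (λ { refl → ¬p pc }) ]′ (m≤n⇒m<n∨m≡n (s≤s⁻¹ c≤k))
  ...   | inj₂ (c , c<k , p , max) = inj₂ (c , m≤n⇒m≤1+n c<k , p ,
    λ c<d d≤k pd → [ (λ d<k → max c<d d<k pd) , (λ { refl → ¬p pd }) ]′ (m≤n⇒m<n∨m≡n (s≤s⁻¹ d≤k)))

-- The extremal family

choose : {P : Set} → Dec P → ℕ → ℕ
choose (yes _) s = s
choose (no  _) s = 1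

choose-yes : {P : Set} (P? : Dec P) {s : ℕ} → P → choose P? s ≡ s
choose-yes (yes _) p = refl
choose-yes (no ¬p) p = contradiction p ¬p

choose-no : {P : Set} (P? : Dec P) {s : ℕ} → ¬ P → choose P? s ≡ 1
choose-no (yes p) ¬p = contradiction p ¬p
choose-no (no _)  ¬p = refl

choose-≤ : {P : Set} (P? : Dec P) {s : ℕ} → 1 ≤ s → choose P? s ≤ s
choose-≤ (yes _) 1≤s = ≤-refl
choose-≤ (no _)  1≤s = 1≤s

choose-≥1 : {P : Set} (P? : Dec P) {s : ℕ} → 1 ≤ s → 1 ≤ choose P? s
choose-≥1 (yes _) 1≤s = 1≤s
choose-≥1 (no _)  1≤s = ≤-refl

-- b is written suc b′.  A member of the family is a point (x , y); its e-th vertex records those coordinates of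
-- x and y that e sees.  The x-coordinates take M values, so that no sunflower with M + 1 petals varies just one of them;
-- the y-coordinates sit at the sizes not in L, which are the only kernel sizes that many petals may have.
module Construction (k M : ℕ) (1≤M : 1 ≤ M) (L : List ℕ) (L<k : All (_< k) L) (a b′ : ℕ)
  (isA : IsA L a) (isB : IsB k L a (suc b′)) where

  Root : ℕ → Set
  Root c = suc b′ < c × c ∉ L

  root? : Decidable Root
  root? c = (suc b′ <? c) ×-dec ¬? (c ∈? L)

  -- Below k there are a + (k - b) such indices, which is the exponent to be reached.
  Free : ℕ → Set
  Free c = c < a ⊎ b′ < c

  free? : Decidable Free
  free? c = (c <? a) ⊎-dec (b′ <? c)

  σx : ℕ → ℕ
  σx c = choose (free? c) M

  Xs : List (Vec ℕ k)
  Xs = box σx k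

  N : ℕ
  N = length Xs

  1≤N : 1 ≤ N
  1≤N = ≤-trans (≤-reflexive (sym (^-zeroˡ k))) (length-box-≥ σx k (λ {c} _ → choose-≥1 (free? c) 1≤M))

  -- N values suffice: a point of a subfamily with no other point of it on its line in direction y_c
  -- accounts for N points of the whole family. Such exceptions thus cost k/N in all, the same order
  -- as the 1/N obtained for the other points.
  σy : ℕ → ℕ
  σy c = choose (root? c) N

  Ys : List (Vec ℕ k)
  Ys = box σy k

  Point : Set
  Point = Vec ℕ k × Vec ℕ k

  x y : Point → ℕ → ℕ
  x (u , _) = at u
  y (_ , v) = at v

  points : List Point
  points = cartesianProduct Xs Ys

  -- The clauses treat c < a, roots, and the other c ≥ b. In the first and third, x_c is recorded
  -- from vertex c on (in the third only by vertices in L), so a first difference at c leaves c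
  -- agreements, once an altered y spoils the later vertices outside L. A root c is hidden from
  -- vertices outside L from c on, so a last difference at c spares vertex c, which brings the b - 1
  -- early vertices up to b. Vertices outside L record nothing of the third kind, so root
  -- coordinates of petals can be handled before those.
  SeesX : ℕ → ℕ → Set
  SeesX e c = (c < a × c ≤ e) ⊎ (Root c × b′ ≤ e × (e ∈ L ⊎ e < c)) ⊎ (b′ < c × c ∈ L × e ∈ L × c ≤ e)

  seesX? : ∀ e c → Dec (SeesX e c)
  seesX? e c = ((c <? a) ×-dec (c ≤? e)) ⊎-dec (root? c ×-dec (b′ ≤? e) ×-dec ((e ∈? L) ⊎-dec (e <? c)))
    ⊎-dec ((b′ <? c) ×-dec (c ∈? L) ×-dec (e ∈? L) ×-dec (c ≤? e))

  _~[_]_ : Point → ℕ → Point → Set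
  p ~[ e ] q = ∀ {c} → c < k → (SeesX e c → x p c ≡ x q c) × (c ≤ e → y p c ≡ y q c)

  ~? : ∀ p e q → Dec (p ~[ e ] q)
  ~? p e q = allUpTo? (λ c → (seesX? e c →-dec (x p c ≟ x q c)) ×-dec ((c ≤? e) →-dec (y p c ≟ y q c))) k

  ~-refl : ∀ {p e} → p ~[ e ] p
  ~-refl _ = (λ _ → refl) , (λ _ → refl)

  ~-sym : ∀ {p e q} → p ~[ e ] q → q ~[ e ] p
  ~-sym p~q c<k = sym ∘ proj₁ (p~q c<k) , sym ∘ proj₂ (p~q c<k)

  ~-trans : ∀ {p e q r} → p ~[ e ] q → q ~[ e ] r → p ~[ e ] r
  ~-trans p~q q~r c<k = (λ s → trans (proj₁ (p~q c<k) s) (proj₁ (q~r c<k) s)) ,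
                        (λ s → trans (proj₂ (p~q c<k) s) (proj₂ (q~r c<k) s))

  open Encoding points _~[_]_ ~? (λ {p} {e} → ~-refl {p} {e}) (λ {p} {e} {q} → ~-sym {p} {e} {q})
    (λ {p} {e} {q} {r} → ~-trans {p} {e} {q} {r}) public

  ∈points⇒ : ∀ {p} → p ∈ points → proj₁ p ∈ Xs × proj₂ p ∈ Ys
  ∈points⇒ p∈ = ∈-cartesianProduct⁻ Xs Ys p∈

  a≤b : a ≤ suc b′
  a≤b = proj₁ isB

  below-a : ∀ {c} → c < a → c ≤ b′
  below-a c<a = s≤s⁻¹ (≤-trans c<a a≤b)

  b∈L : ∀ {c} → c < k → b′ < c → suc b′ ∈ L
  b∈L c<k b′<c with proj₁ (proj₂ isB)
  ... | inj₁ b∈L  = b∈L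
  ... | inj₂ refl = contradiction c<k (≤⇒≯ b′<c)

  k∉L : k ∉ L
  k∉L k∈L = n≮n k (All.lookup L<k k∈L)

  classify : ∀ {c} → c < k → c < a ⊎ Root c ⊎ (b′ < c × c ∈ L) ⊎ ¬ Free c
  classify {c} c<k with c <? a | b′ <? c | c ∈? L
  ... | yes c<a | _       | _      = inj₁ c<a
  ... | no  c≮a | no b′≮c | _      = inj₂ (inj₂ (inj₂ [ c≮a , b′≮c ]′))
  ... | no  _   | yes b′<c | yes c∈L = inj₂ (inj₂ (inj₁ (b′<c , c∈L)))
  ... | no  _   | yes b′<c | no  c∉L = inj₂ (inj₁ (≤∧≢⇒< b′<c (λ { refl → c∉L (b∈L c<k b′<c) }) , c∉L))

  x<M : ∀ {p c} → p ∈ points → c < k → x p c < M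
  x<M {c = c} p∈ c<k = ≤-trans (∈-box⁻ (proj₁ (∈points⇒ p∈)) c<k) (choose-≤ (free? c) 1≤M)

  x-trivial : ∀ {p q c} → p ∈ points → q ∈ points → c < k → ¬ Free c → x p c ≡ x q c
  x-trivial {c = c} p∈ q∈ c<k ¬free = trans (is0 p∈) (sym (is0 q∈))
    where
    is0 : ∀ {p} → p ∈ points → x p c ≡ 0
    is0 p∈ = n<1⇒n≡0 (subst (_ <_) (choose-no (free? c) ¬free) (∈-box⁻ (proj₁ (∈points⇒ p∈)) c<k))

  y-trivial : ∀ {p q c} → p ∈ points → q ∈ points → c < k → ¬ Root c → y p c ≡ y q c
  y-trivial {c = c} p∈ q∈ c<k ¬root = trans (is0 p∈) (sym (is0 q∈))
    where
    is0 : ∀ {p} → p ∈ points → y p c ≡ 0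
    is0 p∈ = n<1⇒n≡0 (subst (_ <_) (choose-no (root? c) ¬root) (∈-box⁻ (proj₂ (∈points⇒ p∈)) c<k))

  ~-intro : ∀ {p q e} → p ∈ points → q ∈ points →
    (∀ {c} → c < a → c ≤ e → x p c ≡ x q c) →
    (∀ {c} → c < k → Root c → b′ ≤ e → e ∈ L ⊎ e < c → x p c ≡ x q c) →
    (∀ {c} → b′ < c → c ∈ L → e ∈ L → c ≤ e → x p c ≡ x q c) →
    (∀ {c} → Root c → c ≤ e → y p c ≡ y q c) → p ~[ e ] q
  ~-intro {p} {q} {e} p∈ q∈ small root nonroot ys {c} c<k = seen , ys′
    where
    seen : SeesX e c → x p c ≡ x q c
    seen (inj₁ (c<a , c≤e))                     = small c<a c≤e
    seen (inj₂ (inj₁ (r , b′≤e , e∈L⊎e<c)))     = root c<k r b′≤e e∈L⊎e<c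
    seen (inj₂ (inj₂ (b′<c , c∈L , e∈L , c≤e))) = nonroot b′<c c∈L e∈L c≤e
    ys′ : c ≤ e → y p c ≡ y q c
    ys′ c≤e with root? c
    ... | yes r  = ys r c≤e
    ... | no  ¬r = y-trivial p∈ q∈ c<k ¬r

  ~-small : ∀ {p q e c} → p ~[ e ] q → e < k → c < a → c ≤ e → x p c ≡ x q c
  ~-small p~q e<k c<a c≤e = proj₁ (p~q (≤-<-trans c≤e e<k)) (inj₁ (c<a , c≤e))

  ~-root : ∀ {p q e c} → p ~[ e ] q → c < k → Root c → b′ ≤ e → e ∈ L ⊎ e < c → x p c ≡ x q c
  ~-root p~q c<k r b′≤e e∈L⊎e<c = proj₁ (p~q c<k) (inj₂ (inj₁ (r , b′≤e , e∈L⊎e<c)))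

  ~-nonroot : ∀ {p q e c} → p ~[ e ] q → e < k → b′ < c → c ∈ L → e ∈ L → c ≤ e → x p c ≡ x q c
  ~-nonroot p~q e<k b′<c c∈L e∈L c≤e = proj₁ (p~q (≤-<-trans c≤e e<k)) (inj₂ (inj₂ (b′<c , c∈L , e∈L , c≤e)))

  ~-y : ∀ {p q e c} → p ~[ e ] q → e < k → c ≤ e → y p c ≡ y q c
  ~-y p~q e<k c≤e = proj₂ (p~q (≤-<-trans c≤e e<k)) c≤e

  ~-all⇒≡ : ∀ {p q} → p ∈ points → q ∈ points → (∀ {e} → e < k → p ~[ e ] q) → p ≡ q
  ~-all⇒≡ {p} {q} p∈ q∈ all = cong₂ _,_ (at-ext (proj₁ p) (proj₁ q) xs) (at-ext (proj₂ p) (proj₂ q) ys)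
    where
    xs : ∀ {c} → c < k → x p c ≡ x q c
    xs {c} c<k with classify c<k
    ... | inj₁ c<a = ~-small {p} {q} (all c<k) c<k c<a ≤-refl
    -- Vertex b - 1 lies below every root and therefore records all root coordinates.
    ... | inj₂ (inj₁ r@(b<c , _)) = ~-root {p} {q} (all (<-trans (<-trans (n<1+n b′) b<c) c<k)) c<k r ≤-refl (inj₂ (<-trans (n<1+n b′) b<c))
    ... | inj₂ (inj₂ (inj₁ (b′<c , c∈L))) = ~-nonroot {p} {q} (all c<k) c<k b′<c c∈L c∈L ≤-refl
    ... | inj₂ (inj₂ (inj₂ ¬free)) = x-trivial {p} {q} p∈ q∈ c<k ¬free
    ys : ∀ {c} → c < k → y p c ≡ y q c
    ys c<k = ~-y {p} {q} (all c<k) c<k ≤-refl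

  family : Family (k * width)
  family = map (encode k) points

  family-Unique : Unique family
  family-Unique = Unique-map (λ p∈ q∈ eq → ~-all⇒≡ p∈ q∈ (encode-≡ k p∈ eq))
    (Unique.cartesianProduct⁺ (box-Unique σx k) (box-Unique σy k))

  family-Uniform : Uniform k family
  family-Uniform = All.map⁺ (All.universal (∣encode∣ k) points)

  family-nonempty : 0 < length family
  family-nonempty = ≤-trans (*-mono-≤ 1≤N (≤-trans (≤-reflexive (sym (^-zeroˡ k))) (length-box-≥ σy k (λ {c} _ → choose-≥1 (root? c) 1≤N))))
    (≤-reflexive (sym (trans (length-map (encode k) points) (length-cartesianProductWith _,_ Xs Ys))))

  -- Cut the indices at a and at b: the middle stretch contributes a factor of at least 1, the two
  -- outer ones at least M per index.
  N-bound : M ^ ((k ∸ suc b′) + a) ≤ N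
  N-bound = begin
    M ^ ((k ∸ suc b′) + a)                                            ≡⟨ cong (M ^_) (+-comm (k ∸ suc b′) a) ⟩
    M ^ (a + (k ∸ suc b′))                                            ≡⟨ ^-distribˡ-+-* M a (k ∸ suc b′) ⟩
    M ^ a * M ^ (k ∸ suc b′)                                          ≤⟨ *-mono-≤ (length-box-≥ σx a (λ {c} c<a → M≤ c (inj₁ c<a))) upper ⟩
    length (box σx a) * length (box (λ i → σx (a + i)) (k ∸ a))       ≡⟨ length-box-+ σx a (k ∸ a) ⟨
    length (box σx (a + (k ∸ a)))                                     ≡⟨ cong (length ∘ box σx) (m+[n∸m]≡n (≤-trans a≤b b≤k)) ⟩
    N                                                                 ∎
    where
    open ≤-Reasoning
    b≤k : suc b′ ≤ k
    b≤k = isB⇒b≤k L<k isB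
    M≤ : ∀ c → Free c → M ≤ σx c
    M≤ c free = ≤-reflexive (sym (choose-yes (free? c) free))
    d = suc b′ ∸ a
    split : k ∸ a ≡ d + (k ∸ suc b′)
    split = begin-equality
      k ∸ a                              ≡⟨ cong (_∸ a) (m+[n∸m]≡n b≤k) ⟨
      suc b′ + (k ∸ suc b′) ∸ a          ≡⟨ +-∸-comm (k ∸ suc b′) a≤b ⟩
      d + (k ∸ suc b′)                   ∎
    upper : M ^ (k ∸ suc b′) ≤ length (box (λ i → σx (a + i)) (k ∸ a))
    upper = begin
      M ^ (k ∸ suc b′)       ≡⟨ *-identityˡ _ ⟨
      1 * M ^ (k ∸ suc b′)   ≤⟨ *-mono-≤
        (≤-trans (≤-reflexive (sym (^-zeroˡ d))) (length-box-≥ (λ i → σx (a + i)) d (λ {i} _ → choose-≥1 (free? (a + i)) 1≤M)))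
        (length-box-≥ (λ i → σx (a + (d + i))) (k ∸ suc b′) (λ {i} _ → M≤ (a + (d + i))
          (inj₂ (subst (suc b′ ≤_) (trans (cong (_+ i) (sym (m+[n∸m]≡n a≤b))) (+-assoc a d i)) (m≤m+n (suc b′) i))))) ⟩
      length (box (λ i → σx (a + i)) d) * length (box (λ i → σx (a + (d + i))) (k ∸ suc b′))
                             ≡⟨ length-box-+ (λ i → σx (a + i)) d (k ∸ suc b′) ⟨
      length (box (λ i → σx (a + i)) (d + (k ∸ suc b′)))
                             ≡⟨ cong (length ∘ box (λ i → σx (a + i))) split ⟨
      length (box (λ i → σx (a + i)) (k ∸ a)) ∎

descend : {P : ℕ → Set} (k : ℕ) → (∀ {c} → c < k → (∀ {d} → c < d → d < k → P d) → P c) → ∀ {c} → c < k → P c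
descend {P} k step {c} c<k = go k c c<k (m≤m+n k c)
  where
  go : ∀ fuel c → c < k → k ≤ fuel + c → P c
  go zero       c c<k k≤ = contradiction c<k (≤⇒≯ k≤)
  go (suc fuel) c c<k k≤ = step c<k λ {d} c<d d<k →
    go fuel d d<k (≤-trans k≤ (≤-trans (≤-reflexive (sym (+-suc fuel c))) (+-monoʳ-≤ fuel c<d)))

-- Kernel sizes of sunflowers in the extremal family

module SunflowerFree (k M : ℕ) (1≤M : 1 ≤ M) (L : List ℕ) (L<k : All (_< k) L) (a b′ : ℕ)
  (isA : IsA L a) (isB : IsB k L a (suc b′)) where

  open Construction k M 1≤M L L<k a b′ isA isB

  module Petals (p : Fin (suc M) → Point) (p∈ : ∀ i → p i ∈ points)
    (meets : ∀ {i j l} → i ≢ j → i ≢ l → encode k (p i) ∩ encode k (p j) ≡ encode k (p i) ∩ encode k (p l)) where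

    Full SameX SameY : ℕ → Set
    Full e  = ∀ i j → p i ~[ e ] p j
    SameX c = ∀ i j → x (p i) c ≡ x (p j) c
    SameY c = ∀ i j → y (p i) c ≡ y (p j) c

    full? : Decidable Full
    full? e = Fin.all? λ i → Fin.all? λ j → ~? (p i) e (p j)

    sameY? : Decidable SameY
    sameY? c = Fin.all? λ i → Fin.all? λ j → y (p i) c ≟ y (p j) c

    -- A vertex common to two petals lies in the kernel, hence in all petals.
    pair⇒full : ∀ {e i j} → i ≢ j → e < k → p i ~[ e ] p j → Full e
    pair⇒full {e} {i} {j} i≢j e<k i~j l₁ l₂ = ~-trans {p l₁} {e} {p i} {p l₂} (~-sym {p i} {e} {p l₁} (to l₁)) (to l₂)
      where
      to : ∀ l → p i ~[ e ] p l
      to l with i Fin.≟ l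
      ... | yes refl = ~-refl {p i} {e}
      ... | no  i≢l  = encode∩-≡ k {p i} {p j} {p l} (p∈ i) (meets i≢j i≢l) {e} e<k i~j

    -- Two of the M + 1 petals share the coordinate c; if this makes them agree at e, then e lies in the kernel.
    promote : ∀ {c e} → c < k → e < k → (∀ i j → x (p i) c ≡ x (p j) c → p i ~[ e ] p j) → Full e
    promote {c} {e} c<k e<k agree
      with i , j , i<j , eq ← Fin.pigeonhole ≤-refl (λ i → fromℕ< (x<M {p i} {c} (p∈ i) c<k))
      = pair⇒full {e} {i} {j} (Fin.<⇒≢ i<j) e<k (agree i j (Fin.fromℕ<-injective (x (p i) c) (x (p j) c) _ _ eq))

    -- For c < a the vertex c records only x_d with d ≤ c. Once the earlier coordinates are
    -- constant, two petals sharing x_c share this vertex, and then all petals do.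
    small-same : ∀ {c} → c < a → c < k → SameX c
    small-same {c} = <-rec (λ c → c < a → c < k → SameX c) step c
      where
      step : ∀ c → (∀ {d} → d < c → d < a → d < k → SameX d) → c < a → c < k → SameX c
      step c ih c<a c<k i₀ j₀ = ~-small {p i₀} {p j₀} {c} (promote {c} {c} c<k c<k agree i₀ j₀) c<k c<a ≤-refl
        where
        agree : ∀ i j → x (p i) c ≡ x (p j) c → p i ~[ c ] p j
        agree i j eq = ~-intro {p i} {p j} {c} (p∈ i) (p∈ j)
          (λ {d} d<a d≤c → [ (λ d<c → ih d<c d<a (<-trans d<c c<k) i j) , (λ { refl → eq }) ]′ (m≤n⇒m<n∨m≡n d≤c))
          -- Here b - 1 ≤ c < a would give a = b, hence b = k, and then no root lies below k.
          (λ d<k r b′≤c _ → contradiction (<-trans (proj₁ r) d<k) (≤⇒≯ (k≤ c<a b′≤c)))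
          (λ b′<d _ _ d≤c → contradiction (≤-trans b′<d d≤c) (≤⇒≯ (below-a c<a)))
          (λ r d≤c → contradiction (<-trans (n<1+n b′) (≤-trans (proj₁ r) d≤c)) (≤⇒≯ (below-a c<a)))
          where
          k≤ : c < a → b′ ≤ c → k ≤ suc b′
          k≤ c<a b′≤c with proj₁ (proj₂ isB)
          ... | inj₁ b∈L  = contradiction b∈L (subst (_∉ L) (≤-antisym a≤b (≤-trans (s≤s b′≤c) c<a)) (proj₁ isA))
          ... | inj₂ refl = ≤-refl

    kernel-size : ∀ hi → hi ≤ k → (∀ {e} → e < hi → Full e) → (∀ {e} → hi ≤ e → e < k → ¬ Full e) →
      ∀ {i j} → i ≢ j → agreements k (p i) (p j) ≡ hi
    kernel-size hi hi≤k below above {i} {j} i≢j = occurrences-initial (λ e → ~? (p i) e (p j)) hi≤k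
      (λ e<hi → below e<hi i j) (λ {e} hi≤e e<k i~j → above hi≤e e<k (pair⇒full {e} {i} {j} i≢j e<k i~j))

    -- The value is the first root at which y varies among the petals, or k; both are outside L. If
    -- it is a root, every later vertex records that y-coordinate and drops out of the kernel, as
    -- does the vertex at the root itself.
    hi-spec : Σ ℕ λ hi → hi ≤ k × hi ∉ L × (∀ {c} → c < hi → Root c → SameY c) × (∀ {e} → hi ≤ e → e < k → ¬ Full e)
    hi-spec with least (λ c → root? c ×-dec ¬? (sameY? c)) k
    ... | inj₁ none = k , ≤-refl , k∉L , (λ {c} c<k r → same c<k r (sameY? c)) , λ k≤e e<k _ → <⇒≱ e<k k≤e
      where
      same : ∀ {c} → c < k → Root c → Dec (SameY c) → SameY c
      same c<k r (yes s) = s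
      same c<k r (no ¬s) = contradiction (r , ¬s) (none c<k)
    ... | inj₂ (hi , hi<k , (r , ¬same) , min) = hi , <⇒≤ hi<k , proj₂ r , (λ {c} c<hi rc → same c<hi rc (sameY? c)) ,
      λ {e} hi≤e e<k full → ¬same (λ i j → ~-y {p i} {p j} {e} (full i j) e<k hi≤e)
      where
      same : ∀ {c} → c < hi → Root c → Dec (SameY c) → SameY c
      same c<hi r (yes s) = s
      same c<hi r (no ¬s) = contradiction (r , ¬s) (min c<hi)

    hi = proj₁ hi-spec
    hi≤k = proj₁ (proj₂ hi-spec)
    hi∉L = proj₁ (proj₂ (proj₂ hi-spec))
    hi-same : ∀ {c} → c < hi → Root c → SameY c
    hi-same = proj₁ (proj₂ (proj₂ (proj₂ hi-spec)))
    hi-above : ∀ {e} → hi ≤ e → e < k → ¬ Full e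
    hi-above = proj₂ (proj₂ (proj₂ (proj₂ hi-spec)))

    -- Before b - 1 the only nontrivial coordinates recorded are the x_c with c < a, which are
    -- constant on the petals.
    early-full : ∀ {e} → e < b′ → e < k → Full e
    early-full {e} e<b′ e<k i j = ~-intro {p i} {p j} {e} (p∈ i) (p∈ j)
      (λ c<a c≤e → small-same c<a (≤-<-trans c≤e e<k) i j)
      (λ _ _ b′≤e _ → contradiction e<b′ (≤⇒≯ b′≤e))
      (λ b′<c _ _ c≤e → contradiction (<-trans e<b′ b′<c) (≤⇒≯ c≤e))
      (λ r c≤e → contradiction (<-trans e<b′ (<-trans (n<1+n b′) (proj₁ r))) (≤⇒≯ c≤e))

    -- Every vertex of the kernel beyond the first b′ sees all x-coordinates indexed by roots c ≥ hi.
    module Beyond (b′∉L : b′ ∉ L) {e₀ : ℕ} (e₀<hi : e₀ < hi) (b′≤e₀ : b′ ≤ e₀) (full₀ : Full e₀) where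

      -- Go down through the roots. Those from `hi` on are recorded by the vertex `e₀`. For c <
      -- `hi`, take the last e < c with b - 1 ≤ e and e outside L; b - 1 itself qualifies. No root
      -- lies strictly between e and c, and e records no nonroot index from b on, so x_c is the only
      -- coordinate at e not yet known to be constant; two petals sharing it put e into the kernel.
      root-same : ∀ {c} → c < k → Root c → SameX c
      root-same = descend {λ c → Root c → SameX c} k step
        where
        step : ∀ {c} → c < k → (∀ {d} → c < d → d < k → Root d → SameX d) → Root c → SameX c
        step {c} c<k ih r i₀ j₀ with hi ≤? c
        ... | yes hi≤c = ~-root {p i₀} {p j₀} {e₀} (full₀ i₀ j₀) c<k r b′≤e₀ (inj₂ (≤-trans e₀<hi hi≤c))
        ... | no  hi≰c with greatest (λ e → (b′ ≤? e) ×-dec ¬? (e ∈? L)) c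
        ...   | inj₁ none = contradiction (≤-refl , b′∉L) (none (<-trans (n<1+n b′) (proj₁ r)))
        ...   | inj₂ (e , e<c , (b′≤e , e∉L) , max) =
          ~-root {p i₀} {p j₀} {e} (promote {c} {e} c<k e<k agree i₀ j₀) c<k r b′≤e (inj₂ e<c)
          where
          e<k = <-trans e<c c<k
          agree : ∀ i j → x (p i) c ≡ x (p j) c → p i ~[ e ] p j
          agree i j eq = ~-intro {p i} {p j} {e} (p∈ i) (p∈ j)
            (λ d<a d≤e → small-same d<a (≤-<-trans d≤e e<k) i j)
            (λ {d} d<k rd _ seen → roots {d} d<k rd seen (<-cmp d c))
            (λ _ _ e∈L _ → contradiction e∈L e∉L)
            (λ rd d≤e → hi-same (<-trans (≤-<-trans d≤e e<c) (≰⇒> hi≰c)) rd i j)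
            where
            roots : ∀ {d} → d < k → Root d → e ∈ L ⊎ e < d → Tri (d < c) (d ≡ c) (c < d) → x (p i) d ≡ x (p j) d
            roots d<k rd (inj₁ e∈L) _               = contradiction e∈L e∉L
            roots d<k rd (inj₂ e<d) (tri< d<c _ _)  = contradiction (≤-trans (n≤1+n b′) (<⇒≤ (proj₁ rd)) , proj₂ rd) (max e<d d<c)
            roots d<k rd (inj₂ e<d) (tri≈ _ refl _) = eq
            roots d<k rd (inj₂ e<d) (tri> _ _ c<d)  = ih c<d d<k rd i j

      full-below : ∀ {e} → e < hi → (∀ {c} → b′ < c → c ∈ L → e ∈ L → c ≤ e → SameX c) → Full e
      full-below {e} e<hi nonroots i j = ~-intro {p i} {p j} {e} (p∈ i) (p∈ j)
        (λ c<a c≤e → small-same c<a (≤-<-trans c≤e (≤-trans e<hi hi≤k)) i j)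
        (λ c<k r _ _ → root-same c<k r i j)
        (λ b′<c c∈L e∈L c≤e → nonroots b′<c c∈L e∈L c≤e i j)
        (λ r c≤e → hi-same (≤-<-trans c≤e e<hi) r i j)

      -- With all roots settled, go upwards: at vertex c only x_c is still open, so two petals
      -- sharing it put c into the kernel.
      nonroot-same : ∀ {c} → c < hi → b′ < c → c ∈ L → SameX c
      nonroot-same {c} = <-rec (λ c → c < hi → b′ < c → c ∈ L → SameX c) step c
        where
        step : ∀ c → (∀ {d} → d < c → d < hi → b′ < d → d ∈ L → SameX d) → c < hi → b′ < c → c ∈ L → SameX c
        step c ih c<hi b′<c c∈L i₀ j₀ =
          ~-nonroot {p i₀} {p j₀} {c} (promote {c} {c} c<k c<k agree i₀ j₀) c<k b′<c c∈L c∈L ≤-refl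
          where
          c<k = ≤-trans c<hi hi≤k
          agree : ∀ i j → x (p i) c ≡ x (p j) c → p i ~[ c ] p j
          agree i j eq = ~-intro {p i} {p j} {c} (p∈ i) (p∈ j)
            (λ d<a d≤c → small-same d<a (≤-<-trans d≤c c<k) i j)
            (λ d<k r _ _ → root-same d<k r i j)
            (λ b′<d d∈L _ d≤c → [ (λ d<c → ih d<c (<-trans d<c c<hi) b′<d d∈L i j) , (λ { refl → eq }) ]′ (m≤n⇒m<n∨m≡n d≤c))
            (λ r d≤c → hi-same (≤-<-trans d≤c c<hi) r i j)

      size : ∀ {i j} → i ≢ j → agreements k (p i) (p j) ≡ hi
      size = kernel-size hi hi≤k
        (λ e<hi → full-below e<hi (λ b′<c c∈L _ c≤e → nonroot-same (≤-<-trans c≤e e<hi) b′<c c∈L)) hi-above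

    -- If a = b, then b = k and all k vertices lie in the kernel. Otherwise the kernel consists
    -- either of all vertices below `hi` or of the first b - 1 only, and b - 1 is outside L because
    -- a ≤ b - 1 < b.
    kernel∉L : ∀ {i j} → i ≢ j → agreements k (p i) (p j) ∉ L
    kernel∉L {i} {j} i≢j with m≤n⇒m<n∨m≡n a≤b
    ... | inj₂ refl = subst (_∉ L) (sym (kernel-size k ≤-refl all-full (λ k≤e e<k _ → <⇒≱ e<k k≤e) i≢j)) k∉L
      where
      k≡b : suc b′ ≡ k
      k≡b with proj₁ (proj₂ isB)
      ... | inj₁ b∈L = contradiction b∈L (proj₁ isA)
      ... | inj₂ eq  = eq
      e<b : ∀ {e} → e < k → e < suc b′
      e<b = subst (_ <_) (sym k≡b)
      all-full : ∀ {e} → e < k → Full e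
      all-full {e} e<k i j = ~-intro {p i} {p j} {e} (p∈ i) (p∈ j)
        (λ c<a c≤e → small-same c<a (≤-<-trans c≤e e<k) i j)
        (λ c<k r _ _ → contradiction (proj₁ r) (<⇒≯ (e<b c<k)))
        (λ b′<c _ _ c≤e → contradiction (≤-<-trans c≤e (e<b e<k)) (≤⇒≯ b′<c))
        (λ r c≤e → contradiction (proj₁ r) (<⇒≯ (≤-<-trans c≤e (e<b e<k))))
    ... | inj₁ a<b with anyUpTo? (λ e → (b′ ≤? e) ×-dec full? e) hi
    ...   | yes (e₀ , e₀<hi , b′≤e₀ , full₀) = subst (_∉ L) (sym (Beyond.size b′∉L e₀<hi b′≤e₀ full₀ i≢j)) hi∉L
      where b′∉L = proj₁ (proj₂ (proj₂ isB) b′ (s≤s⁻¹ a<b) ≤-refl)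
    ...   | no none = subst (_∉ L) (sym (kernel-size b′ b′≤k (λ e<b′ → early-full e<b′ (≤-trans e<b′ b′≤k)) above i≢j)) b′∉L
      where
      b′∉L = proj₁ (proj₂ (proj₂ isB) b′ (s≤s⁻¹ a<b) ≤-refl)
      b′≤k : b′ ≤ k
      b′≤k = ≤-trans (n≤1+n b′) (isB⇒b≤k L<k isB)
      above : ∀ {e} → b′ ≤ e → e < k → ¬ Full e
      above {e} b′≤e e<k full with e <? hi
      ... | yes e<hi = none (e , e<hi , b′≤e , full)
      ... | no  e≮hi = hi-above (≮⇒≥ e≮hi) e<k full

  no-sunflower : ¬ HasLSunflower L (suc M) family
  no-sunflower (S , (inj , meet) , S∈ , K∈L) = go 1≤M
    where
    chosen : ∀ i → ∃ λ q → q ∈ points × S i ≡ encode k q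
    chosen i = ∈-map⁻ (encode k) (S∈ i)
    p : Fin (suc M) → Point
    p i = proj₁ (chosen i)
    p≡ : ∀ i → S i ≡ encode k (p i)
    p≡ i = proj₂ (proj₂ (chosen i))
    to-kernel : ∀ {i j} → i ≢ j → encode k (p i) ∩ encode k (p j) ≡ kernel S
    to-kernel {i} {j} i≢j = trans (cong₂ _∩_ (sym (p≡ i)) (sym (p≡ j))) (meet i j i≢j)
    open Petals p (λ i → proj₁ (proj₂ (chosen i))) (λ i≢j i≢l → trans (to-kernel i≢j) (sym (to-kernel i≢l)))
    go : 1 ≤ M → Empty.⊥
    go (s≤s _) = kernel∉L {zero} {suc zero} (λ ()) (subst (_∈ L)
      (trans (cong ∣_∣ (sym (to-kernel {zero} {suc zero} (λ ())))) (∣encode∩encode∣ k (proj₁ (proj₂ (chosen zero))))) K∈L)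

-- Size of the L-avoiding subfamilies of the extremal family

AllPairs-lookup : {R : A → A → Set} → (∀ {x y} → R x y → R y x) → {xs : List A} → AllPairs R xs →
  ∀ {x y} → x ∈ xs → y ∈ xs → x ≡ y ⊎ R x y
AllPairs-lookup sym-R (r ∷ rs) (here refl) (here refl) = inj₁ refl
AllPairs-lookup sym-R (r ∷ rs) (here refl) (there y∈)  = inj₂ (All.lookup r y∈)
AllPairs-lookup sym-R (r ∷ rs) (there x∈)  (here refl) = inj₂ (sym-R (All.lookup r x∈))
AllPairs-lookup sym-R (r ∷ rs) (there x∈)  (there y∈)  = AllPairs-lookup sym-R rs x∈ y∈

preimages : {f : A → B} {xs : List A} {ys : List B} → All (_∈ map f xs) ys →
  Σ (List A) λ zs → ys ≡ map f zs × All (_∈ xs) zs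
preimages []                = [] , refl , []
preimages {f = f} (y∈ ∷ ys) with ∈-map⁻ f y∈ | preimages ys
... | z , z∈ , refl | zs , refl , zs∈ = z ∷ zs , refl , z∈ ∷ zs∈

put-≡⇒at : {u v : Vec ℕ n} {i j : ℕ} (s t : ℕ) → put u i s ≡ put v i t → j ≢ i → at u j ≡ at v j
put-≡⇒at {u = u} {v} {i} {j} s t eq j≢i = trans (sym (at-put-≢ u s j≢i)) (trans (cong (λ w → at w j) eq) (at-put-≢ v t j≢i))

module AvoidingSubfamily (k M : ℕ) (1≤M : 1 ≤ M) (L : List ℕ) (L<k : All (_< k) L) (a b′ : ℕ)
  (isA : IsA L a) (isB : IsB k L a (suc b′)) where

  open Construction k M 1≤M L L<k a b′ isA isB

  module _ (ps : List Point) (ps-Unique : Unique ps) (ps⊆ : ∀ {p} → p ∈ ps → p ∈ points)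
    (avoids : ∀ {p q} → p ∈ ps → q ∈ ps → agreements k p q ∉ L) where

    -- Writing 0 at index c erases that coordinate, so twins differ in y_c and nowhere else.
    Twin : ℕ → Point → Point → Set
    Twin c p q = proj₁ p ≡ proj₁ q × put (proj₂ p) c 0 ≡ put (proj₂ q) c 0 × y p c ≢ y q c

    hasTwin? : ∀ c → Decidable (λ p → Any (Twin c p) ps)
    hasTwin? c p = any? (λ q → ≡-dec _≟_ (proj₁ p) (proj₁ q) ×-dec ≡-dec _≟_ (put (proj₂ p) c 0) (put (proj₂ q) c 0)
      ×-dec ¬? (y p c ≟ y q c)) ps

    Typical : Point → Set
    Typical p = ∀ {c} → c < k → Root c → Any (Twin c p) ps

    -- Here `hi` is the next root after c, and p′ is p altered in y from there on; if no root
    -- follows, `hi` is k, p itself serves, and the inequality at `hi` is vacuous.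
    Varied : ℕ → Point → ℕ → Point → Set
    Varied c p hi p′ = p′ ∈ ps × proj₁ p ≡ proj₁ p′ × c < hi × (∀ {d} → d < hi → y p d ≡ y p′ d)
      × (∀ {e} → hi ≤ e → e < k → y p hi ≢ y p′ hi) × (∀ {d} → c < d → d < hi → ¬ Root d)

    vary : ∀ {p c} → p ∈ ps → Typical p → c < k → ∃ λ hi → ∃ (Varied c p hi)
    vary {p} {c} p∈ typ c<k with least (λ d → (c <? d) ×-dec root? d) k
    ... | inj₁ none = k , p , p∈ , refl , c<k , (λ _ → refl) , (λ k≤e e<k → contradiction k≤e (<⇒≱ e<k)) , λ c<d d<k r → none d<k (c<d , r)
    ... | inj₂ (hi , hi<k , (c<hi , r) , min) with find (typ hi<k r)
    ...   | p′ , p′∈ , same-x , same-y , diff = hi , p′ , p′∈ , same-x , c<hi ,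
      (λ d<hi → put-≡⇒at 0 0 same-y (<⇒≢ d<hi)) , (λ _ _ → diff) , λ c<d d<hi rd → min d<hi (c<d , rd)

    -- If p and q differ in x only, then q meets p, or p with one y-coordinate altered, in a size belonging to L.
    module _ {p q : Point} (p∈ : p ∈ ps) (q∈ : q ∈ ps) (typ : Typical p) (same-y : proj₂ p ≡ proj₂ q) where

      y≡ : ∀ c → y p c ≡ y q c
      y≡ c = cong (λ v → at v c) same-y

      -- A first difference at c < a is recorded by all vertices from c on and by no earlier one, so
      -- exactly c vertices agree, and c lies in L.
      differ-small : ∀ {c} → c < k → c < a → x p c ≢ x q c → ¬ (∀ {d} → d < c → x p d ≡ x q d)
      differ-small {c} c<k c<a ≢c below = avoids p∈ q∈ (subst (_∈ L) (sym size) (proj₂ isA c c<a))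
        where
        size : agreements k p q ≡ c
        size = occurrences-initial (λ e → ~? p e q) (<⇒≤ c<k)
          (λ {e} e<c → ~-intro {p} {q} {e} (ps⊆ p∈) (ps⊆ q∈)
            (λ _ d≤e → below (≤-<-trans d≤e e<c))
            (λ _ _ b′≤e _ → contradiction (≤-trans e<c (below-a c<a)) (≤⇒≯ b′≤e))
            (λ b′<d _ _ d≤e → contradiction (≤-trans b′<d (≤-trans d≤e (<⇒≤ e<c))) (≤⇒≯ (below-a c<a)))
            (λ {d} _ _ → y≡ d))
          (λ {e} c≤e e<k p~q → ≢c (~-small {p} {q} {e} p~q e<k c<a c≤e))

      module _ (small : ∀ {c} → c < a → c < k → x p c ≡ x q c) where

        -- Use p′, that is p with y altered at the next root `hi`, if there is one. The vertices
        -- before b - 1 agree, and so does c, which records only roots above c and y up to c. Any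
        -- other vertex from b - 1 on fails: below c, or beyond c and in L, it records x_c; beyond c
        -- and outside L it is a root, so at least `hi`, and records the altered y. This makes (b -
        -- 1) + 1 = b agreements, and b lies in L.
        differ-root : ∀ {c} → c < k → Root c → x p c ≢ x q c → ¬ (∀ {d} → c < d → d < k → Root d → x p d ≡ x q d)
        differ-root {c} c<k r@(b<c , c∉L) ≢c above with vary p∈ typ c<k
        ... | hi , p′ , p′∈ , same-x , c<hi , same-below , diff , no-root =
          avoids p′∈ q∈ (subst (_∈ L) (sym size) (b∈L c<k (<-trans (n<1+n b′) b<c)))
          where
          x′ : ∀ d → x p′ d ≡ x p d
          x′ d = cong (λ u → at u d) (sym same-x)
          y′ : ∀ {d} → d < hi → y p′ d ≡ y q d
          y′ {d} d<hi = trans (sym (same-below d<hi)) (y≡ d)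
          b′<c = <-trans (n<1+n b′) b<c
          others : ∀ {e} → b′ ≤ e → e < k → e ≢ c → ¬ p′ ~[ e ] q
          others {e} b′≤e e<k e≢c p~q with <-cmp e c | e ∈? L
          ... | tri< e<c _ _ | _       = ≢c (trans (sym (x′ c)) (~-root {p′} {q} {e} p~q c<k r b′≤e (inj₂ e<c)))
          ... | tri≈ _ e≡c _ | _       = e≢c e≡c
          ... | tri> _ _ c<e | yes e∈L = ≢c (trans (sym (x′ c)) (~-root {p′} {q} {e} p~q c<k r b′≤e (inj₁ e∈L)))
          ... | tri> _ _ c<e | no  e∉L = diff hi≤e e<k (trans (y≡ hi) (sym (~-y {p′} {q} {e} p~q e<k hi≤e)))
            where
            hi≤e : hi ≤ e
            hi≤e = ≮⇒≥ (λ e<hi → no-root c<e e<hi (<-trans b<c c<e , e∉L))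
          size : agreements k p′ q ≡ suc b′
          size = occurrences-initial+1 (λ e → ~? p′ e q) {b′} {c} {k} (<⇒≤ b′<c) c<k
            (λ {e} e<b′ → ~-intro {p′} {q} {e} (ps⊆ p′∈) (ps⊆ q∈)
              (λ {d} d<a d≤e → trans (x′ d) (small d<a (≤-<-trans d≤e (<-trans e<b′ (<-trans b′<c c<k)))))
              (λ _ _ b′≤e _ → contradiction e<b′ (≤⇒≯ b′≤e))
              (λ b′<d _ _ d≤e → contradiction (<-trans e<b′ b′<d) (≤⇒≯ d≤e))
              (λ rd d≤e → contradiction (<-trans e<b′ (<-trans (n<1+n b′) (proj₁ rd))) (≤⇒≯ d≤e)))
            (~-intro {p′} {q} {c} (ps⊆ p′∈) (ps⊆ q∈)
              (λ {d} d<a d≤c → trans (x′ d) (small d<a (≤-<-trans d≤c c<k)))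
              (λ { _ _ _ (inj₁ c∈L) → contradiction c∈L c∉L ; {d} d<k rd _ (inj₂ c<d) → trans (x′ d) (above c<d d<k rd) })
              (λ _ _ c∈L _ → contradiction c∈L c∉L)
              (λ _ d≤c → y′ (≤-<-trans d≤c c<hi)))
            others

        module _ (roots : ∀ {c} → c < k → Root c → x p c ≡ x q c) where

          -- After the same alteration, all vertices below c agree. From c on, those in L record
          -- x_c, and those outside L are roots at or beyond `hi` and record the altered y. So
          -- exactly c vertices agree.
          differ-nonroot : ∀ {c} → c < k → b′ < c → c ∈ L → x p c ≢ x q c →
            ¬ (∀ {d} → d < c → b′ < d → d ∈ L → x p d ≡ x q d)
          differ-nonroot {c} c<k b′<c c∈L ≢c below with vary p∈ typ c<k
          ... | hi , p′ , p′∈ , same-x , c<hi , same-below , diff , no-root = avoids p′∈ q∈ (subst (_∈ L) (sym size) c∈L)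
            where
            x′ : ∀ d → x p′ d ≡ x p d
            x′ d = cong (λ u → at u d) (sym same-x)
            y′ : ∀ {d} → d < hi → y p′ d ≡ y q d
            y′ {d} d<hi = trans (sym (same-below d<hi)) (y≡ d)
            above : ∀ {e} → c ≤ e → e < k → ¬ p′ ~[ e ] q
            above {e} c≤e e<k p~q with e ∈? L
            ... | yes e∈L = ≢c (trans (sym (x′ c)) (~-nonroot {p′} {q} {e} p~q e<k b′<c c∈L e∈L c≤e))
            ... | no  e∉L = diff hi≤e e<k (trans (y≡ hi) (sym (~-y {p′} {q} {e} p~q e<k hi≤e)))
              where
              c<e : c < e
              c<e = ≤∧≢⇒< c≤e (λ { refl → e∉L c∈L })
              hi≤e : hi ≤ e
              hi≤e = ≮⇒≥ (λ e<hi → no-root c<e e<hi (≤-<-trans b′<c c<e , e∉L))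
            size : agreements k p′ q ≡ c
            size = occurrences-initial (λ e → ~? p′ e q) (<⇒≤ c<k)
              (λ {e} e<c → ~-intro {p′} {q} {e} (ps⊆ p′∈) (ps⊆ q∈)
                (λ {d} d<a d≤e → trans (x′ d) (small d<a (≤-<-trans d≤e (<-trans e<c c<k))))
                (λ {d} d<k rd _ _ → trans (x′ d) (roots d<k rd))
                (λ {d} b′<d d∈L _ d≤e → trans (x′ d) (below (≤-<-trans d≤e e<c) b′<d d∈L))
                (λ _ d≤e → y′ (<-trans (≤-<-trans d≤e e<c) c<hi)))
              above

      stable : ∀ c → ¬ (x p c ≢ x q c) → x p c ≡ x q c
      stable c = decidable-stable (x p c ≟ x q c)

      -- The order of the searches is forced by what each kind of difference presupposes: indices
      -- below a upwards, then roots downwards, then the remaining indices in L upwards.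
      typical⇒≡ : p ≡ q
      typical⇒≡ = cong₂ _,_ (at-ext (proj₁ p) (proj₁ q) same) same-y
        where
        ≢? : Decidable (λ c → x p c ≢ x q c)
        ≢? c = ¬? (x p c ≟ x q c)
        small : ∀ {c} → c < a → c < k → x p c ≡ x q c
        small {c} c<a c<k with least (λ c → (c <? a) ×-dec ≢? c) k
        ... | inj₁ none = stable c (λ ≢c → none c<k (c<a , ≢c))
        ... | inj₂ (d , d<k , (d<a , ≢d) , min) =
          contradiction (λ {e} e<d → stable e (λ ≢e → min e<d (<-trans e<d d<a , ≢e))) (differ-small d<k d<a ≢d)
        roots : ∀ {c} → c < k → Root c → x p c ≡ x q c
        roots {c} c<k r with greatest (λ c → root? c ×-dec ≢? c) k
        ... | inj₁ none = stable c (λ ≢c → none c<k (r , ≢c))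
        ... | inj₂ (d , d<k , (rd , ≢d) , max) =
          contradiction (λ {e} d<e e<k re → stable e (λ ≢e → max d<e e<k (re , ≢e))) (differ-root small d<k rd ≢d)
        nonroots : ∀ {c} → c < k → b′ < c → c ∈ L → x p c ≡ x q c
        nonroots {c} c<k b′<c c∈L with least (λ c → (b′ <? c) ×-dec (c ∈? L) ×-dec ≢? c) k
        ... | inj₁ none = stable c (λ ≢c → none c<k (b′<c , c∈L , ≢c))
        ... | inj₂ (d , d<k , (b′<d , d∈L , ≢d) , min) =
          contradiction (λ {e} e<d b′<e e∈L → stable e (λ ≢e → min e<d (b′<e , e∈L , ≢e))) (differ-nonroot small roots d<k b′<d d∈L ≢d)
        same : ∀ {c} → c < k → x p c ≡ x q c
        same c<k with classify c<k
        ... | inj₁ c<a                          = small c<a c<k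
        ... | inj₂ (inj₁ r)                     = roots c<k r
        ... | inj₂ (inj₂ (inj₁ (b′<c , c∈L)))   = nonroots c<k b′<c c∈L
        ... | inj₂ (inj₂ (inj₂ ¬free))          = x-trivial {p} {q} (ps⊆ p∈) (ps⊆ q∈) c<k ¬free

    -- Let y_c run through all N values at each twinless point. The resulting points are distinct,
    -- since two points of `ps` on the same line would be twins.
    twinless-count : ∀ {c} → c < k → Root c → N * # (¬? ∘ hasTwin? c) ps ≤ length points
    twinless-count {c} c<k r = begin
      N * length lonely                                     ≡⟨ *-comm N (length lonely) ⟩
      length lonely * N                                     ≡⟨ cong (length lonely *_) (length-upTo N) ⟨
      length lonely * length (upTo N)                       ≡⟨ length-cartesianProductWith _,_ lonely (upTo N) ⟨
      length (cartesianProduct lonely (upTo N))             ≡⟨ length-map f (cartesianProduct lonely (upTo N)) ⟨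
      length (map f (cartesianProduct lonely (upTo N)))     ≤⟨ Unique-⊆⇒length≤ (Unique-map inj (Unique.cartesianProduct⁺ (Unique.filter⁺ _ ps-Unique) (Unique.upTo⁺ N))) into ⟩
      length points                                         ∎
      where
      open ≤-Reasoning
      lonely = filter (¬? ∘ hasTwin? c) ps
      f : Point × ℕ → Point
      f ((u , v) , t) = u , put v c t
      split : ∀ {p t} → (p , t) ∈ cartesianProduct lonely (upTo N) → (p ∈ ps × ¬ Any (Twin c p) ps) × t < N
      split pt∈ = let p∈ , t∈ = ∈-cartesianProduct⁻ lonely (upTo N) pt∈
                  in ∈-filter⁻ (¬? ∘ hasTwin? c) {xs = ps} p∈ , ∈-upTo⁻ t∈
      into : ∀ {z} → z ∈ map f (cartesianProduct lonely (upTo N)) → z ∈ points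
      into z∈ with ∈-map⁻ f z∈
      ... | ((u , v) , t) , pt∈ , refl with split pt∈
      ...   | (p∈ , _) , t<N = ∈-cartesianProduct⁺ (proj₁ (∈points⇒ (ps⊆ p∈))) (∈-box⁺ bounded)
        where
        bounded : ∀ {d} → d < k → at (put v c t) d < σy d
        bounded {d} d<k with d ≟ c
        ... | yes refl = subst₂ _<_ (sym (at-put v t c<k)) (sym (choose-yes (root? c) r)) t<N
        ... | no  d≢c  = subst (_< σy d) (sym (at-put-≢ v t d≢c)) (∈-box⁻ (proj₂ (∈points⇒ (ps⊆ p∈))) d<k)
      inj : ∀ {z w} → z ∈ cartesianProduct lonely (upTo N) → w ∈ cartesianProduct lonely (upTo N) → f z ≡ f w → z ≡ w
      inj {(u , v) , s} {(u′ , v′) , t} z∈ w∈ eq with split z∈ | split w∈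
      ... | (p∈ , lone) , _ | (q∈ , _) , _ = cong₂ _,_ (cong₂ _,_ u≡ (at-ext v v′ v≡)) s≡t
        where
        u≡ : u ≡ u′
        u≡ = cong proj₁ eq
        puts : put v c s ≡ put v′ c t
        puts = cong proj₂ eq
        s≡t : s ≡ t
        s≡t = trans (sym (at-put v s c<k)) (trans (cong (λ w → at w c) puts) (at-put v′ t c<k))
        zeroed : ∀ {d} → d < k → at (put v c 0) d ≡ at (put v′ c 0) d
        zeroed {d} d<k with d ≟ c
        ... | yes refl = trans (at-put v 0 c<k) (sym (at-put v′ 0 c<k))
        ... | no  d≢c  = trans (at-put-≢ v 0 d≢c) (trans (put-≡⇒at s t puts d≢c) (sym (at-put-≢ v′ 0 d≢c)))
        v≡ : ∀ {d} → d < k → at v d ≡ at v′ d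
        v≡ {d} d<k with d ≟ c
        ... | no  d≢c  = put-≡⇒at s t puts d≢c
        ... | yes refl = decidable-stable (at v c ≟ at v′ c) λ ≢c →
          lone (lose q∈ (u≡ , at-ext (put v c 0) (put v′ c 0) zeroed , ≢c))

    Twinless : ℕ → Point → Set
    Twinless j p = ∃ λ c → c < j × Root c × ¬ Any (Twin c p) ps

    twinless? : ∀ j → Decidable (Twinless j)
    twinless? j p = anyUpTo? (λ c → root? c ×-dec ¬? (hasTwin? c p)) j

    all-twinless-count : ∀ j → j ≤ k → N * # (twinless? j) ps ≤ j * length points
    all-twinless-count zero    _   = ≤-reflexive (trans (cong (λ l → N * length l)
      (filter-none (twinless? 0) {xs = ps} (All.universal (λ _ (_ , c<0 , _) → n≮0 c<0) ps))) (*-zeroʳ N))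
    all-twinless-count (suc j) j<k = begin
      N * # (twinless? (suc j)) ps                      ≤⟨ *-monoʳ-≤ N (#-≤-+ (twinless? (suc j)) last? (twinless? j) ps (λ _ → split)) ⟩
      N * (# last? ps + # (twinless? j) ps)             ≡⟨ *-distribˡ-+ N (# last? ps) _ ⟩
      N * # last? ps + N * # (twinless? j) ps           ≤⟨ +-mono-≤ last-count (all-twinless-count j (<⇒≤ j<k)) ⟩
      length points + j * length points                 ∎
      where
      open ≤-Reasoning
      last? : Decidable (λ p → Root j × ¬ Any (Twin j p) ps)
      last? p = root? j ×-dec ¬? (hasTwin? j p)
      split : ∀ {p} → Twinless (suc j) p → (Root j × ¬ Any (Twin j p) ps) ⊎ Twinless j p
      split (c , c≤j , r , lone) with m≤n⇒m<n∨m≡n (s≤s⁻¹ c≤j)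
      ... | inj₁ c<j  = inj₂ (c , c<j , r , lone)
      ... | inj₂ refl = inj₁ (r , lone)
      last-count : N * # last? ps ≤ length points
      last-count = by-root (root? j)
        where
        by-root : Dec (Root j) → N * # last? ps ≤ length points
        by-root (yes r) = ≤-trans (*-monoʳ-≤ N (#-mono last? (¬? ∘ hasTwin? j) ps (λ _ → proj₂))) (twinless-count j<k r)
        by-root (no ¬r) = ≤-trans (≤-reflexive (trans (cong (λ l → N * length l)
          (filter-none last? {xs = ps} (All.universal (λ _ → ¬r ∘ proj₁) ps))) (*-zeroʳ N))) z≤n

    -- A typical point is determined by its y among the typical ones, so replacing its x by each of
    -- the N vectors of `Xs` never produces the same point twice.
    typical-count : N * # (¬? ∘ twinless? k) ps ≤ length points
    typical-count = begin
      N * length typical                                  ≡⟨ length-cartesianProductWith _,_ Xs typical ⟨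
      length (cartesianProduct Xs typical)                ≡⟨ length-map f (cartesianProduct Xs typical) ⟨
      length (map f (cartesianProduct Xs typical))        ≤⟨ Unique-⊆⇒length≤ (Unique-map inj (Unique.cartesianProduct⁺ (box-Unique σx k) (Unique.filter⁺ _ ps-Unique))) into ⟩
      length points                                       ∎
      where
      open ≤-Reasoning
      typical = filter (¬? ∘ twinless? k) ps
      f : Vec ℕ k × Point → Point
      f (u , p) = u , proj₂ p
      split : ∀ {u p} → (u , p) ∈ cartesianProduct Xs typical → u ∈ Xs × p ∈ ps × Typical p
      split {p = p} up∈ with ∈-cartesianProduct⁻ Xs typical up∈
      ... | u∈ , p∈ with ∈-filter⁻ (¬? ∘ twinless? k) {xs = ps} p∈
      ...   | p∈ps , ¬twinless = u∈ , p∈ps , λ {c} c<k r → decidable-stable (hasTwin? c p) (λ lone → ¬twinless (c , c<k , r , lone))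
      into : ∀ {z} → z ∈ map f (cartesianProduct Xs typical) → z ∈ points
      into z∈ with ∈-map⁻ f z∈
      ... | _ , up∈ , refl with split up∈
      ...   | u∈ , p∈ , _ = ∈-cartesianProduct⁺ u∈ (proj₂ (∈points⇒ (ps⊆ p∈)))
      inj : ∀ {z w} → z ∈ cartesianProduct Xs typical → w ∈ cartesianProduct Xs typical → f z ≡ f w → z ≡ w
      inj {_ , p} {_ , q} z∈ w∈ eq with split z∈ | split w∈
      ... | _ , p∈ , typ | _ , q∈ , _ = cong₂ _,_ (cong proj₁ eq) (typical⇒≡ {p} {q} p∈ q∈ typ (cong proj₂ eq))

    count : N * length ps ≤ suc k * length points
    count = begin
      N * length ps                                                     ≡⟨ cong (N *_) (#-complement (¬? ∘ twinless? k) ps) ⟩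
      N * (# (¬? ∘ twinless? k) ps + # (¬? ∘ ¬? ∘ twinless? k) ps)      ≡⟨ *-distribˡ-+ N (# (¬? ∘ twinless? k) ps) _ ⟩
      N * # (¬? ∘ twinless? k) ps + N * # (¬? ∘ ¬? ∘ twinless? k) ps    ≤⟨ +-mono-≤ typical-count (≤-trans
        (*-monoʳ-≤ N (#-mono (¬? ∘ ¬? ∘ twinless? k) (twinless? k) ps (λ {p} _ → decidable-stable (twinless? k p)))) (all-twinless-count k ≤-refl)) ⟩
      suc k * length points                                             ∎
      where open ≤-Reasoning

  family-bound : (F′ : Family (k * width)) → SubFamily F′ family → AvoidsL L F′ →
    N * length F′ ≤ suc k * length family
  family-bound F′ (uniq , F′⊆) avoid with preimages F′⊆
  ... | ps , refl , ps⊆ = begin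
    N * length (map (encode k) ps)    ≡⟨ cong (N *_) (length-map (encode k) ps) ⟩
    N * length ps                     ≤⟨ count ps (Unique.map⁻ uniq) (All.lookup ps⊆) avoids ⟩
    suc k * length points             ≡⟨ cong (suc k *_) (length-map (encode k) points) ⟨
    suc k * length family             ∎
    where
    open ≤-Reasoning
    avoids : ∀ {p q} → p ∈ ps → q ∈ ps → agreements k p q ∉ L
    avoids {p} {q} p∈ q∈ ∈L with AllPairs-lookup (λ {p} {q} → subst (λ I → ¬ (∣ I ∣ ∈ L)) (∩-comm (encode k p) (encode k q)))
                                   (AllPairs.map⁻ avoid) p∈ q∈
    ... | inj₂ ∉L   = ∉L (subst (_∈ L) (sym (∣encode∩encode∣ k (All.lookup ps⊆ p∈))) ∈L)
    ... | inj₁ refl = k∉L (subst (_∈ L) (trans (sym (∣encode∩encode∣ k {p} {p} (All.lookup ps⊆ p∈)))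
                        (trans (cong ∣_∣ (∩-idem (encode k p))) (∣encode∣ k p))) ∈L)

-- Passing to rational constants

module _ where
  open ℚᵘ.≤-Reasoning

  ℕtoℚᵘ : ℕ → ℚᵘ.ℚᵘ
  ℕtoℚᵘ x = ℚᵘ.mkℚᵘ (ℤ.+ x) 0

  toℚᵘ-ℕtoℚ : ∀ x → ℚ.toℚᵘ (ℕtoℚ x) ℚᵘ.≃ ℕtoℚᵘ x
  toℚᵘ-ℕtoℚ x = ℚ.toℚᵘ-fromℚᵘ (ℕtoℚᵘ x)

  ℕtoℚ-mono-≤ : ∀ {m n} → m ≤ n → ℕtoℚ m ≤ℚ ℕtoℚ n
  ℕtoℚ-mono-≤ {m} {n} m≤n = ℚ.toℚᵘ-cancel-≤ (begin
    ℚ.toℚᵘ (ℕtoℚ m)   ≃⟨ toℚᵘ-ℕtoℚ m ⟩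
    ℕtoℚᵘ m           ≤⟨ ℚᵘ.*≤* (ℤ.*-monoʳ-≤-nonNeg (ℤ.+ 1) (ℤ.+≤+ m≤n)) ⟩
    ℕtoℚᵘ n           ≃⟨ toℚᵘ-ℕtoℚ n ⟨
    ℚ.toℚᵘ (ℕtoℚ n)   ∎)

  ℕtoℚ-homo-* : ∀ m n → ℕtoℚ (m * n) ≡ ℕtoℚ m *ℚ ℕtoℚ n
  ℕtoℚ-homo-* m n = ℚ.toℚᵘ-injective (begin-equality
    ℚ.toℚᵘ (ℕtoℚ (m * n))                     ≃⟨ toℚᵘ-ℕtoℚ (m * n) ⟩
    ℕtoℚᵘ (m * n)                             ≡⟨ cong (λ z → ℚᵘ.mkℚᵘ z 0) (ℤ.pos-* m n) ⟩
    ℕtoℚᵘ m ℚᵘ.* ℕtoℚᵘ n                      ≃⟨ ℚᵘ.*-cong (toℚᵘ-ℕtoℚ m) (toℚᵘ-ℕtoℚ n) ⟨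
    ℚ.toℚᵘ (ℕtoℚ m) ℚᵘ.* ℚ.toℚᵘ (ℕtoℚ n)      ≃⟨ ℚ.toℚᵘ-homo-* (ℕtoℚ m) (ℕtoℚ n) ⟨
    ℚ.toℚᵘ (ℕtoℚ m *ℚ ℕtoℚ n)                 ∎)

ℕtoℚ-positive : ∀ {n} → 0 < n → ℚ.Positive (ℕtoℚ n)
ℕtoℚ-positive {suc n} _ = ℚ.normalize-pos (suc n) 1

ℕtoℚ-nonNegative : ∀ n → ℚ.NonNegative (ℕtoℚ n)
ℕtoℚ-nonNegative n = ℚ.normalize-nonNeg n 1

-- If b = 0 then a = 0, and 0 ∉ L leaves only b = k, which is positive. This justifies writing b as
-- `suc b′` in the construction.
IsB⇒1≤b : ∀ {k L a b} → 1 ≤ k → IsA L a → IsB k L a b → 1 ≤ b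
IsB⇒1≤b {b = suc b} _   _             _                       = s≤s z≤n
IsB⇒1≤b {b = zero}  1≤k (a∉L , below) (z≤n , inj₁ b∈L  , _) = contradiction b∈L a∉L
IsB⇒1≤b {b = zero}  1≤k isA           (z≤n , inj₂ refl , _) = 1≤k

-- The power of 2 pays for using m - 1 ≥ m / 2 values under an exponent of at most k + k; the factor
-- `suc k` combines the typical points with up to k kinds of twinless ones.
upper-constant : ℕ → ℕ
upper-constant k = 2 ^ (k + k) * suc k

upper-bound : ∀ k → 1 ≤ k → ∀ m → 2 ≤ m → ∀ (L : SizeSet k) a b → IsA (proj₁ L) a → IsB k (proj₁ L) a b →
  Σ ℕ λ n → Σ (Family n) λ F → Unique F × Uniform k F × ¬ HasLSunflower (proj₁ L) m F × 0 < length F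
    × (∀ F′ → SubFamily F′ F → AvoidsL (proj₁ L) F′ → m ^ ((k ∸ b) + a) * length F′ ≤ upper-constant k * length F)
upper-bound k 1≤k (suc M) (s≤s 1≤M) (L , L<k) a zero     isA isB = contradiction (IsB⇒1≤b 1≤k isA isB) λ ()
upper-bound k 1≤k (suc M) (s≤s 1≤M) (L , L<k) a (suc b′) isA isB =
  k * width , family , family-Unique , family-Uniform , SunflowerFree.no-sunflower k M 1≤M L L<k a b′ isA isB , family-nonempty , bound
  where
  open Construction k M 1≤M L L<k a b′ isA isB
  open ≤-Reasoning
  e = (k ∸ suc b′) + a
  e≤ : e ≤ k + k
  e≤ = +-mono-≤ (m∸n≤m k (suc b′)) (≤-trans a≤b (isB⇒b≤k L<k isB))
  bound : ∀ F′ → SubFamily F′ family → AvoidsL L F′ → suc M ^ e * length F′ ≤ upper-constant k * length family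
  bound F′ sub avoid = begin
    suc M ^ e * length F′                   ≤⟨ *-monoˡ-≤ (length F′) (^-monoˡ-≤ e (+-mono-≤ 1≤M (m≤m+n M 0))) ⟩
    (2 * M) ^ e * length F′                 ≡⟨ cong (_* length F′) (^-distribʳ-* 2 M e) ⟩
    2 ^ e * M ^ e * length F′               ≤⟨ *-monoˡ-≤ (length F′) (*-mono-≤ (^-monoʳ-≤ 2 e≤) N-bound) ⟩
    2 ^ (k + k) * N * length F′             ≡⟨ *-assoc (2 ^ (k + k)) N (length F′) ⟩
    2 ^ (k + k) * (N * length F′)           ≤⟨ *-monoʳ-≤ (2 ^ (k + k)) (AvoidingSubfamily.family-bound k M 1≤M L L<k a b′ isA isB F′ sub avoid) ⟩
    2 ^ (k + k) * (suc k * length family)   ≡⟨ *-assoc (2 ^ (k + k)) (suc k) (length family) ⟨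
    upper-constant k * length family        ∎

theorem1p2 : ∀ (k : ℕ) → 1 ≤ k →
    (Σ ℚ λ c → 0ℚ <ℚ c ×
    (∀ (m : ℕ) → 2 ≤ m → ∀ (L : SizeSet k) (a b : ℕ) →
    IsA (proj₁ L) a → IsB k (proj₁ L) a b →
    ∀ (n : ℕ) (F : Family n) → Unique F → Uniform k F →
    ¬ HasLSunflower (proj₁ L) m F →
    Σ (Family n) λ F' → SubFamily F' F × AvoidsL (proj₁ L) F' ×
    (c *ℚ ℕtoℚ (length F) ≤ℚ ℕtoℚ (m ^ ((k ∸ b) + a)) *ℚ ℕtoℚ (length F'))))
    × (Σ ℚ λ C → 0ℚ <ℚ C ×
    (∀ (m : ℕ) → 2 ≤ m → ∀ (L : SizeSet k) (a b : ℕ) →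
    IsA (proj₁ L) a → IsB k (proj₁ L) a b →
    ∀ (α : ℚ) → Admissible k (proj₁ L) m α →
    α *ℚ ℕtoℚ (m ^ ((k ∸ b) + a)) ≤ℚ C))
theorem1p2 k 1≤k = (c , 0<c , lower) , (ℕtoℚ C , 0<C , upper)
  where
  open ℚ.≤-Reasoning
  D C : ℕ
  D = lower-constant k
  C = upper-constant k
  instance
    D-positive : ℚ.Positive (ℕtoℚ D)
    D-positive = ℕtoℚ-positive (*-mono-≤ (m^n>0 k {{ℕ.>-nonZero 1≤k}} k) (s≤s z≤n))
    D-nonZero : ℚ.NonZero (ℕtoℚ D)
    D-nonZero = ℚ.pos⇒nonZero (ℕtoℚ D)
  c : ℚ
  c = ℚ.1/ ℕtoℚ D
  0<c : 0ℚ <ℚ c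
  0<c = ℚ.positive⁻¹ c {{ℚ.1/pos⇒pos (ℕtoℚ D)}}
  0<C : 0ℚ <ℚ ℕtoℚ C
  0<C = ℚ.positive⁻¹ (ℕtoℚ C) {{ℕtoℚ-positive (*-mono-≤ (m^n>0 2 (k + k)) (s≤s z≤n))}}
  lower : ∀ m → 2 ≤ m → ∀ (L : SizeSet k) a b → IsA (proj₁ L) a → IsB k (proj₁ L) a b →
    ∀ n (F : Family n) → Unique F → Uniform k F → ¬ HasLSunflower (proj₁ L) m F →
    Σ (Family n) λ F′ → SubFamily F′ F × AvoidsL (proj₁ L) F′ ×
    (c *ℚ ℕtoℚ (length F) ≤ℚ ℕtoℚ (m ^ ((k ∸ b) + a)) *ℚ ℕtoℚ (length F′))
  lower m 2≤m L a b isA isB n F uniq unif none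
    with F′ , sub , avoid , le ← lower-bound k 1≤k m 2≤m L a b isA isB n F uniq unif none = F′ , sub , avoid , (begin
    c *ℚ ℕtoℚ (length F)                ≤⟨ ℚ.*-monoˡ-≤-nonNeg c {{ℚ.pos⇒nonNeg c {{ℚ.1/pos⇒pos (ℕtoℚ D)}}}} (ℕtoℚ-mono-≤ le) ⟩
    c *ℚ ℕtoℚ (D * (w * length F′))     ≡⟨ cong (c *ℚ_) (ℕtoℚ-homo-* D (w * length F′)) ⟩
    c *ℚ (ℕtoℚ D *ℚ ℕtoℚ (w * length F′))   ≡⟨ ℚ.*-assoc c (ℕtoℚ D) _ ⟨
    c *ℚ ℕtoℚ D *ℚ ℕtoℚ (w * length F′)     ≡⟨ cong (_*ℚ ℕtoℚ (w * length F′)) (ℚ.*-inverseˡ (ℕtoℚ D)) ⟩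
    ℚ.1ℚ *ℚ ℕtoℚ (w * length F′)        ≡⟨ ℚ.*-identityˡ _ ⟩
    ℕtoℚ (w * length F′)                ≡⟨ ℕtoℚ-homo-* w (length F′) ⟩
    ℕtoℚ w *ℚ ℕtoℚ (length F′)          ∎)
    where w = m ^ ((k ∸ b) + a)
  upper : ∀ m → 2 ≤ m → ∀ (L : SizeSet k) a b → IsA (proj₁ L) a → IsB k (proj₁ L) a b →
    ∀ α → Admissible k (proj₁ L) m α → α *ℚ ℕtoℚ (m ^ ((k ∸ b) + a)) ≤ℚ ℕtoℚ C
  upper m 2≤m L a b isA isB α (_ , admissible)
    with n , F , uniq , unif , none , 0<F , bound ← upper-bound k 1≤k m 2≤m L a b isA isB
    with F′ , sub , avoid , le ← admissible n F uniq unif none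
    -- One nonempty family suffices to bound α: compare both estimates for the same subfamily and
    -- cancel the size of the family.
    = ℚ.*-cancelʳ-≤-pos (ℕtoℚ (length F)) {{ℕtoℚ-positive 0<F}} (begin
    α *ℚ ℕtoℚ w *ℚ ℕtoℚ (length F)      ≡⟨ ℚ.*-assoc α (ℕtoℚ w) _ ⟩
    α *ℚ (ℕtoℚ w *ℚ ℕtoℚ (length F))    ≡⟨ cong (α *ℚ_) (ℚ.*-comm (ℕtoℚ w) (ℕtoℚ (length F))) ⟩
    α *ℚ (ℕtoℚ (length F) *ℚ ℕtoℚ w)    ≡⟨ ℚ.*-assoc α (ℕtoℚ (length F)) _ ⟨
    α *ℚ ℕtoℚ (length F) *ℚ ℕtoℚ w      ≤⟨ ℚ.*-monoʳ-≤-nonNeg (ℕtoℚ w) {{ℕtoℚ-nonNegative w}} le ⟩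
    ℕtoℚ (length F′) *ℚ ℕtoℚ w          ≡⟨ ℚ.*-comm (ℕtoℚ (length F′)) (ℕtoℚ w) ⟩
    ℕtoℚ w *ℚ ℕtoℚ (length F′)          ≡⟨ ℕtoℚ-homo-* w (length F′) ⟨
    ℕtoℚ (w * length F′)                ≤⟨ ℕtoℚ-mono-≤ (bound F′ sub avoid) ⟩
    ℕtoℚ (C * length F)                 ≡⟨ ℕtoℚ-homo-* C (length F) ⟩
    ℕtoℚ C *ℚ ℕtoℚ (length F)           ∎)
    where w = m ^ ((k ∸ b) + a)
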